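{- For every $\varepsilon>0$ and positive integers $s,d$, there exist $p=p(s,d,\varepsilon)$ and $L=L(s,d,\varepsilon)$ such that for every Abelian group $G$ in which every non-identity element has order greater than $p$, and every $n$, the family $\mathcal{J}_d([s]^n,G)$ is $(1/s^d-\varepsilon,\ L)$-list decodable.
   Context: $\mathcal{J}_d([s]^n,G)$ is the set of functions $[s]^n\to G$ that are sums of $d$-juntas (functions depending on at most $d$ coordinates). A family $\mathcal{F}$ of functions $D\to G$ is $(\varepsilon,L)$-list decodable if for every $f:D\to G$ at most $L$ functions $P\in\mathcal{F}$ satisfy $\delta(f,P)\le\varepsilon$, where $\delta(f,P)$ is the fraction of inputs on which $f,P$ differ. -}

module Defs where

open import Level using (Level; Setω)
open import Algebra.Bundles using (AbelianGroup)
open import Data.Nat using (ℕ; zero; suc; _≤_; _^_; NonZero)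
open import Data.Nat.Properties using (m^n≢0)
open import Data.Fin using (Fin)
open import Data.Vec using (Vec; lookup)
open import Data.List using (List; length)
open import Data.List.Membership.Propositional using (_∈_)
open import Data.List.Relation.Unary.All using (All)
open import Data.List.Relation.Unary.AllPairs using (AllPairs)
open import Data.List.Relation.Unary.Unique.Propositional using (Unique)
open import Data.Product using (Σ; _×_)
open import Data.Integer using (+_)
open import Data.Rational using (ℚ; _/_; _-_) renaming (_≤_ to _≤ℚ_)
open import Relation.Nullary using (¬_)
open import Relation.Binary.PropositionalEquality using (_≡_)

Cube : ℕ → ℕ → Set
Cube s n = Vec (Fin s) n

-- Existential over two naturals whose body may quantify over all universe levels.
record ∃₂ω (P : ℕ → ℕ → Setω) : Setω where
  constructor _,_,_
  field
    p : ℕ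
    L : ℕ
    holds : P p L

radius : (s d : ℕ) → .{{NonZero s}} → ℚ → ℚ
radius s d eps = ((+ 1) / (s ^ d)) {{m^n≢0 s d}} - eps

module _ {c ℓ : Level} (G : AbelianGroup c ℓ) where
  open AbelianGroup G

  mult : ℕ → Carrier → Carrier
  mult zero    g = ε
  mult (suc k) g = g ∙ mult k g

  OrdersExceed : ℕ → Set (c Level.⊔ ℓ)
  OrdersExceed p = ∀ (g : Carrier) → ¬ (g ≈ ε) →
                   ∀ (k : ℕ) → 1 ≤ k → k ≤ p → ¬ (mult k g ≈ ε)

  IsJunta : (s n d : ℕ) → (Cube s n → Carrier) → Set ℓ
  IsJunta s n d g =
    Σ (List (Fin n)) λ S → length S ≤ d ×
      (∀ (x y : Cube s n) → (∀ i → i ∈ S → lookup x i ≡ lookup y i) → g x ≈ g y)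

  sumFns : ∀ {s n} → List (Cube s n → Carrier) → Cube s n → Carrier
  sumFns List.[] x = ε
  sumFns (g List.∷ gs) x = g x ∙ sumFns gs x

  InJ : (s n d : ℕ) → (Cube s n → Carrier) → Set (c Level.⊔ ℓ)
  InJ s n d P =
    Σ (List (Cube s n → Carrier)) λ gs →
      All (IsJunta s n d) gs × (∀ x → P x ≈ sumFns gs x)

  DistLe : (s n : ℕ) → .{{NonZero s}} → (Cube s n → Carrier) → (Cube s n → Carrier) → ℚ → Set ℓ
  DistLe s n f P r =
    Σ (List (Cube s n)) λ D → Unique D ×
      (∀ x → ¬ (f x ≈ P x) → x ∈ D) ×
      ((+ length D) / (s ^ n)) {{m^n≢0 s n}} ≤ℚ r

  Distinct : ∀ {s n} → (Cube s n → Carrier) → (Cube s n → Carrier) → Set ℓ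
  Distinct P Q = ¬ (∀ x → P x ≈ Q x)

  ListDecodable : (s n : ℕ) → .{{NonZero s}} → (F : (Cube s n → Carrier) → Set (c Level.⊔ ℓ)) → ℚ → ℕ → Set (c Level.⊔ ℓ)
  ListDecodable s n F r L =
    ∀ (f : Cube s n → Carrier) (Ps : List (Cube s n → Carrier)) →
      All F Ps → AllPairs Distinct Ps → All (λ P → DistLe s n f P r) Ps →
      length Ps ≤ L

{-# OPTIONS --safe #-}
module Submission where

-- Write σ = 1/s. Passing to differences with one member of the list, every member becomes a function
-- Q in J_d that is nonzero with probability at most 2σ^d - 2ε ≤ σ^(d-1) - ε.
--
-- Such a Q depends on boundedly many coordinates. By induction on d each derivative of Q in a single
-- coordinate has this property, because its support is at most s times as large; so if Q had many relevant
-- coordinates, many of them would have derivatives on disjoint sets of coordinates. At most points, many of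
-- these derivatives are nonzero, and as a function of the chosen coordinates alone Q is a sum of many
-- independent non-constant terms. Since nonzero elements of G have large order, a set of few elements is not
-- invariant under a nonzero translation, and therefore such a sum takes each value with small probability:
-- Q would be nonzero almost everywhere.
--
-- Now consider members depending on a bounded core C and otherwise on disjoint sets of coordinates. Given the
-- coordinates in C they are independent, so by a variance bound f does essentially no better on average than a
-- function g of the coordinates in C. But a member of J_d that depends on a coordinate outside C differs from
-- g with probability at least σ^d, and the members that depend only on C and are closer to g than that are
-- determined by the set where they agree with g. So there are boundedly many of them, and moving the
-- coordinates of a maximal such family into C shrinks the remaining coordinates of every member.

open import Defs using (Cube; radius; ∃₂ω; OrdersExceed; ListDecodable; InJ; DistLe) renaming (_,_,_ to mk∃₂ω)
import Defs
open import Level using (Level; 0ℓ)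
open import Function using (_∘_)
open import Algebra.Bundles using (AbelianGroup)
import Algebra.Properties.AbelianGroup as AbelianGroupₚ
open import Data.Empty using (⊥; ⊥-elim)
open import Data.Bool as Bool using (Bool; true; false; not; _∧_; _∨_; if_then_else_)
open import Data.Nat as ℕ using (ℕ; zero; suc; z≤n; s≤s; NonZero)
import Data.Nat.Properties as ℕₚ
open import Data.Integer as ℤ using (+_; -[1+_])
import Data.Integer.Properties as ℤₚ
import Data.Integer.Tactic.RingSolver as ℤ-Solver
open import Data.Rational using (ℚ; mkℚ; 0ℚ; 1ℚ; ½; _+_; _*_; _-_; -_; _≤_; _<_; _/_; *<*; toℚᵘ; positive; nonNegative)
open import Data.Rational.Properties hiding (_≟_)
import Data.Rational.Properties as ℚₚ
import Data.Rational.Unnormalised as ℚᵘ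
import Data.Rational.Unnormalised.Properties as ℚᵘₚ
open import Data.Fin as Fin using (Fin; zero; suc; toℕ)
open import Data.Fin.Properties using (pigeonhole; toℕ≤pred[n])
open import Data.Vec as Vec using ([]; _∷_; lookup; _[_]≔_)
import Data.Vec.Properties as Vecₚ
open import Data.List as List using (List; []; _∷_; length; map; _++_; concatMap; allFin; filter; take; drop)
open import Data.List.Properties using (length-tabulate; map-tabulate; length-++; length-map; length-take; length-drop; take++drop≡id; filter-notAll)
open import Data.List.Membership.Propositional using (_∈_; _∉_)
open import Data.List.Membership.Propositional.Properties using (∈-allFin; ∈-filter⁺; ∈-filter⁻; ∈-concatMap⁺; ∈-map⁺; ∈-lookup; ∈-++⁺ˡ; ∈-++⁺ʳ)
import Data.List.Membership.DecPropositional as DecMembership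
open import Data.List.Relation.Unary.Any as Any using (Any; here; there; any?)
open import Data.List.Relation.Unary.All as All using (All; []; _∷_)
import Data.List.Relation.Unary.All.Properties as Allₚ
open import Data.List.Relation.Unary.AllPairs as AllPairs using (AllPairs; []; _∷_)
import Data.List.Relation.Unary.AllPairs.Properties as AllPairsₚ
open import Data.List.Relation.Unary.Unique.Propositional.Properties using (allFin⁺)
open import Data.List.Relation.Binary.Pointwise using (Pointwise; []; _∷_)
open import Data.List.Relation.Binary.Sublist.Propositional using (_⊆_; []; _∷_; _∷ʳ_)
open import Data.List.Relation.Binary.Sublist.Propositional.Properties using (All-resp-⊆)
open import Data.Product using (Σ; _×_; _,_; proj₁; proj₂; ∃)
open import Data.Sum using (_⊎_; inj₁; inj₂; [_,_]′)
open import Relation.Nullary using (¬_; yes; no; does; Dec)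
open import Relation.Nullary.Decidable using (decidable-stable; ¬?; ¬¬-excluded-middle)
open import Relation.Nullary.Decidable.Core using (dec⇒maybe)
open import Relation.Binary.PropositionalEquality using (_≡_; refl; sym; trans; cong; cong₂; subst; module ≡-Reasoning)
import Tactic.RingSolver.Core.AlmostCommutativeRing as ACR
open import Tactic.RingSolver using (solve-∀)

private variable
  ℓa ℓb ℓ : Level
  A : Set ℓa
  B : Set ℓb
  n r : ℕ

-- Rational arithmetic.

ℚ-ring : ACR.AlmostCommutativeRing 0ℓ 0ℓ
ℚ-ring = ACR.fromCommutativeRing +-*-commutativeRing λ x → dec⇒maybe (0ℚ ℚₚ.≟ x)

infixr 8 _^_
_^_ : ℚ → ℕ → ℚ
x ^ zero  = 1ℚ
x ^ suc k = x * x ^ k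

2ℚ : ℚ
2ℚ = 1ℚ + 1ℚ

0≤1 : 0ℚ ≤ 1ℚ
0≤1 = nonNegative⁻¹ 1ℚ

0<1 : 0ℚ < 1ℚ
0<1 = positive⁻¹ 1ℚ

0≤+ : ∀ {x y} → 0ℚ ≤ x → 0ℚ ≤ y → 0ℚ ≤ x + y
0≤+ = +-mono-≤

0≤* : ∀ {x y} → 0ℚ ≤ x → 0ℚ ≤ y → 0ℚ ≤ x * y
0≤* {x} {y} p q = nonNegative⁻¹ _ {{nonNeg*nonNeg⇒nonNeg x {{nonNegative p}} y {{nonNegative q}}}}

0<* : ∀ {x y} → 0ℚ < x → 0ℚ < y → 0ℚ < x * y
0<* {x} {y} p q = positive⁻¹ _ {{pos*pos⇒pos x {{positive p}} y {{positive q}}}}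

≤⇒0≤- : ∀ {x y} → x ≤ y → 0ℚ ≤ y - x
≤⇒0≤- {x} {y} p = subst (_≤ y - x) (+-inverseʳ x) (+-monoˡ-≤ (- x) p)

<⇒0<- : ∀ {x y} → x < y → 0ℚ < y - x
<⇒0<- {x} {y} p = subst (_< y - x) (+-inverseʳ x) (+-monoˡ-< (- x) p)

≤-by : ∀ {x y} e → 0ℚ ≤ e → y ≡ x + e → x ≤ y
≤-by {x} e p refl = subst (_≤ x + e) (+-identityʳ x) (+-monoʳ-≤ x p)

<-by : ∀ {x y} e → 0ℚ < e → y ≡ x + e → x < y
<-by {x} e p refl = subst (_< x + e) (+-identityʳ x) (+-monoʳ-< x p)

*-mono-≤ˡ : ∀ {x y} k → 0ℚ ≤ k → x ≤ y → k * x ≤ k * y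
*-mono-≤ˡ k p q = *-monoˡ-≤-nonNeg k {{nonNegative p}} q

0≤^ : ∀ {x} k → 0ℚ ≤ x → 0ℚ ≤ x ^ k
0≤^ zero    p = 0≤1
0≤^ (suc k) p = 0≤* p (0≤^ k p)

0<^ : ∀ {x} k → 0ℚ < x → 0ℚ < x ^ k
0<^ zero    p = 0<1
0<^ (suc k) p = 0<* p (0<^ k p)

^≤1 : ∀ {x} k → 0ℚ ≤ x → x ≤ 1ℚ → x ^ k ≤ 1ℚ
^≤1 zero    p q = ≤-refl
^≤1 {x} (suc k) p q = ≤-trans (*-mono-≤ˡ x p (^≤1 k p q)) (subst (_≤ 1ℚ) (sym (*-identityʳ x)) q)

ι : ℕ → ℚ
ι zero    = 0ℚ
ι (suc k) = 1ℚ + ι k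

0≤ι : ∀ k → 0ℚ ≤ ι k
0≤ι zero    = ≤-refl
0≤ι (suc k) = 0≤+ 0≤1 (0≤ι k)

0<ι : ∀ k → 0ℚ < ι (suc k)
0<ι k = +-mono-<-≤ 0<1 (0≤ι k)

ι-+ : ∀ m n → ι (m ℕ.+ n) ≡ ι m + ι n
ι-+ zero    n = sym (+-identityˡ _)
ι-+ (suc m) n = trans (cong (_+_ 1ℚ) (ι-+ m n)) (sym (+-assoc 1ℚ (ι m) (ι n)))

ι-* : ∀ m n → ι (m ℕ.* n) ≡ ι m * ι n
ι-* zero    n = sym (*-zeroˡ (ι n))
ι-* (suc m) n = trans (trans (ι-+ n (m ℕ.* n)) (cong (_+_ (ι n)) (ι-* m n))) (lem (ι m) (ι n))
  where
  lem : ∀ a b → b + a * b ≡ (1ℚ + a) * b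
  lem = solve-∀ ℚ-ring

ι-^ : ∀ m n → ι (m ℕ.^ n) ≡ ι m ^ n
ι-^ m zero    = +-identityʳ 1ℚ
ι-^ m (suc n) = trans (ι-* m (m ℕ.^ n)) (cong (_*_ (ι m)) (ι-^ m n))

ι-mono : ∀ {m n} → m ℕ.≤ n → ι m ≤ ι n
ι-mono {n = n} z≤n = 0≤ι n
ι-mono (s≤s p) = +-monoʳ-≤ 1ℚ (ι-mono p)

ι-cancel-≤ : ∀ {m n} → ι m ≤ ι n → m ℕ.≤ n
ι-cancel-≤ {m} {n} p with m ℕ.≤? n
... | yes q = q
... | no ¬q = ⊥-elim (<-irrefl refl (<-≤-trans (<-≤-trans lt (ι-mono (ℕₚ.≰⇒> ¬q))) p))
  where
  lt : ι n < ι (suc n)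
  lt = <-by 1ℚ 0<1 (+-comm 1ℚ (ι n))

/-as-* : ∀ k n .{{_ : NonZero n}} → (+ k) / n ≡ ι k * ((+ 1) / n)
/-as-* zero    n = trans (0/n≡0 n) (sym (*-zeroˡ ((+ 1) / n)))
/-as-* (suc k) n = trans (trans (step k n) (cong (_+_ ((+ 1) / n)) (/-as-* k n))) (lem (ι k) ((+ 1) / n))
  where
  lem : ∀ a b → b + a * b ≡ (1ℚ + a) * b
  lem = solve-∀ ℚ-ring
  step : ∀ k n .{{_ : NonZero n}} → (+ suc k) / n ≡ (+ 1) / n + (+ k) / n
  step k (suc n) = toℚᵘ-injective (begin
      toℚᵘ ((+ suc k) / suc n)                             ≈⟨ toℚᵘ-fromℚᵘ (ℚᵘ.mkℚᵘ (+ suc k) n) ⟩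
      ℚᵘ.mkℚᵘ (+ suc k) n                                  ≈⟨ ℚᵘ.*≡* (eq (+ k) (+ suc n)) ⟩
      ℚᵘ.mkℚᵘ (+ 1) n ℚᵘ.+ ℚᵘ.mkℚᵘ (+ k) n                 ≈⟨ ℚᵘₚ.+-cong (toℚᵘ-fromℚᵘ (ℚᵘ.mkℚᵘ (+ 1) n)) (toℚᵘ-fromℚᵘ (ℚᵘ.mkℚᵘ (+ k) n)) ⟨
      toℚᵘ ((+ 1) / suc n) ℚᵘ.+ toℚᵘ ((+ k) / suc n)       ≈⟨ toℚᵘ-homo-+ ((+ 1) / suc n) ((+ k) / suc n) ⟨
      toℚᵘ ((+ 1) / suc n + (+ k) / suc n) ∎)
    where
    open ℚᵘₚ.≃-Reasoning
    eq : ∀ a b → (+ 1 ℤ.+ a) ℤ.* (b ℤ.* b) ≡ (+ 1 ℤ.* b ℤ.+ a ℤ.* b) ℤ.* b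
    eq = ℤ-Solver.solve-∀

ι*1/ : ∀ n .{{_ : NonZero n}} → ι n * ((+ 1) / n) ≡ 1ℚ
ι*1/ n = trans (sym (/-as-* n n)) (n/n n)
  where
  n/n : ∀ n .{{_ : NonZero n}} → (+ n) / n ≡ 1ℚ
  n/n (suc n) = fromℚᵘ-cong {ℚᵘ.mkℚᵘ (+ suc n) n} {ℚᵘ.mkℚᵘ (+ 1) 0} (ℚᵘ.*≡* (ℤₚ.*-comm (+ suc n) (+ 1)))

square≥0 : ∀ y → 0ℚ ≤ y * y
square≥0 y with ≤-total 0ℚ y
... | inj₁ h = 0≤* h h
... | inj₂ h = subst (0ℚ ≤_) (lem y) (0≤* (neg-antimono-≤ h) (neg-antimono-≤ h))
  where
  lem : ∀ y → - y * - y ≡ y * y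
  lem = solve-∀ ℚ-ring

-- Opaque, so that conversion checking treats these as names and does not normalise rational
-- arithmetic.
opaque
  decide-< : ∀ (p q : ℚ) → Dec (p < q)
  decide-< p q = p <? q

  recip : ℕ → ℚ
  recip k = (+ 1) / suc k

  recip≡ : ∀ k → recip k ≡ (+ 1) / suc k
  recip≡ k = refl

  ι*recip : ∀ k → ι (suc k) * recip k ≡ 1ℚ
  ι*recip k = ι*1/ (suc k)

  0<recip : ∀ k → 0ℚ < recip k
  0<recip k = positive⁻¹ ((+ 1) / suc k) {{normalize-pos 1 (suc k)}}

-- Finite sums and indicators.

sum : List A → (A → ℚ) → ℚ
sum []       f = 0ℚ
sum (x ∷ xs) f = f x + sum xs f

sum-cong : ∀ (xs : List A) {f g : A → ℚ} → (∀ x → f x ≡ g x) → sum xs f ≡ sum xs g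
sum-cong []       e = refl
sum-cong (x ∷ xs) e = cong₂ _+_ (e x) (sum-cong xs e)

sum-mono-All : ∀ {xs : List A} {f g : A → ℚ} → All (λ x → f x ≤ g x) xs → sum xs f ≤ sum xs g
sum-mono-All []       = ≤-refl
sum-mono-All (p ∷ ps) = +-mono-≤ p (sum-mono-All ps)

sum-mono : ∀ (xs : List A) {f g : A → ℚ} → (∀ x → f x ≤ g x) → sum xs f ≤ sum xs g
sum-mono xs p = sum-mono-All (All.universal p xs)

sum-0 : ∀ (xs : List A) → sum xs (λ _ → 0ℚ) ≡ 0ℚ
sum-0 []       = refl
sum-0 (x ∷ xs) = trans (+-identityˡ _) (sum-0 xs)

sum-≥0 : ∀ (xs : List A) {f : A → ℚ} → (∀ x → 0ℚ ≤ f x) → 0ℚ ≤ sum xs f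
sum-≥0 []       p = ≤-refl
sum-≥0 (x ∷ xs) p = 0≤+ (p x) (sum-≥0 xs p)

sum-+ : ∀ (xs : List A) (f g : A → ℚ) → sum xs (λ x → f x + g x) ≡ sum xs f + sum xs g
sum-+ []       f g = sym (+-identityˡ 0ℚ)
sum-+ (x ∷ xs) f g = trans (cong (_+_ (f x + g x)) (sum-+ xs f g)) (lem (f x) (g x) (sum xs f) (sum xs g))
  where
  lem : ∀ a b c d → a + b + (c + d) ≡ a + c + (b + d)
  lem = solve-∀ ℚ-ring

sum-* : ∀ (xs : List A) k (f : A → ℚ) → sum xs (λ x → k * f x) ≡ k * sum xs f
sum-* []       k f = sym (*-zeroʳ k)
sum-* (x ∷ xs) k f = trans (cong (_+_ (k * f x)) (sum-* xs k f)) (sym (*-distribˡ-+ k (f x) (sum xs f)))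

sum-const : ∀ (xs : List A) k → sum xs (λ _ → k) ≡ ι (length xs) * k
sum-const []       k = sym (*-zeroˡ k)
sum-const (x ∷ xs) k = trans (cong (_+_ k) (sum-const xs k)) (lem k (ι (length xs)))
  where
  lem : ∀ a b → a + b * a ≡ (1ℚ + b) * a
  lem = solve-∀ ℚ-ring

sum-++ : ∀ (xs ys : List A) (f : A → ℚ) → sum (xs ++ ys) f ≡ sum xs f + sum ys f
sum-++ []       ys f = sym (+-identityˡ _)
sum-++ (x ∷ xs) ys f = trans (cong (_+_ (f x)) (sum-++ xs ys f)) (sym (+-assoc (f x) _ _))

sum-map : ∀ (xs : List A) (h : A → B) (f : B → ℚ) → sum (map h xs) f ≡ sum xs (λ x → f (h x))
sum-map []       h f = refl
sum-map (x ∷ xs) h f = cong (_+_ (f (h x))) (sum-map xs h f)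

sum-concatMap : ∀ (xs : List A) (h : A → List B) (f : B → ℚ) →
                sum (concatMap h xs) f ≡ sum xs (λ x → sum (h x) f)
sum-concatMap []       h f = refl
sum-concatMap (x ∷ xs) h f = trans (sum-++ (h x) (concatMap h xs) f) (cong (_+_ (sum (h x) f)) (sum-concatMap xs h f))

sum-swap : ∀ (xs : List A) (ys : List B) (f : A → B → ℚ) →
           sum xs (λ x → sum ys (f x)) ≡ sum ys (λ y → sum xs (λ x → f x y))
sum-swap []       ys f = sym (sum-0 ys)
sum-swap (x ∷ xs) ys f = trans (cong (_+_ (sum ys (f x))) (sum-swap xs ys f)) (sym (sum-+ ys (f x) _))

∈⇒≤sum : ∀ {xs : List A} {f : A → ℚ} {x} → (∀ x → 0ℚ ≤ f x) → x ∈ xs → f x ≤ sum xs f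
∈⇒≤sum {xs = y ∷ xs} {f} nn (here refl) = ≤-by (sum xs f) (sum-≥0 xs nn) refl
∈⇒≤sum {xs = y ∷ xs} {f} nn (there p) = ≤-trans (∈⇒≤sum nn p) (≤-by (f y) (nn y) (+-comm (f y) (sum xs f)))

∈₂⇒+≤sum : ∀ {xs : List A} {f : A → ℚ} {x y} → (∀ x → 0ℚ ≤ f x) → ¬ x ≡ y → x ∈ xs → y ∈ xs → f x + f y ≤ sum xs f
∈₂⇒+≤sum nn ne (here refl) (here refl) = ⊥-elim (ne refl)
∈₂⇒+≤sum {f = f} {x} nn ne (here refl) (there q) = +-monoʳ-≤ (f x) (∈⇒≤sum nn q)
∈₂⇒+≤sum {f = f} {x} {y} nn ne (there p) (here refl) = subst (_≤ _) (+-comm (f y) (f x)) (+-monoʳ-≤ (f y) (∈⇒≤sum nn p))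
∈₂⇒+≤sum {xs = z ∷ xs} {f} nn ne (there p) (there q) = ≤-trans (∈₂⇒+≤sum nn ne p q) (≤-by (f z) (nn z) (+-comm (f z) (sum xs f)))

𝟙 : Bool → ℚ
𝟙 true  = 1ℚ
𝟙 false = 0ℚ

0≤𝟙 : ∀ b → 0ℚ ≤ 𝟙 b
0≤𝟙 true  = 0≤1
0≤𝟙 false = ≤-refl

𝟙≤1 : ∀ b → 𝟙 b ≤ 1ℚ
𝟙≤1 true  = ≤-refl
𝟙≤1 false = 0≤1

𝟙-not : ∀ b → 𝟙 (not b) ≡ 1ℚ - 𝟙 b
𝟙-not true  = refl
𝟙-not false = refl

𝟙-∨ : ∀ b c → 𝟙 (b ∨ c) ≤ 𝟙 b + 𝟙 c
𝟙-∨ true  c = ≤-by (𝟙 c) (0≤𝟙 c) refl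
𝟙-∨ false c = ≤-reflexive (sym (+-identityˡ (𝟙 c)))

𝟙-mono : ∀ {b c} → (b ≡ true → c ≡ true) → 𝟙 b ≤ 𝟙 c
𝟙-mono {true}  {c} h = ≤-reflexive (cong 𝟙 (sym (h refl)))
𝟙-mono {false} {c} h = 0≤𝟙 c

-- Relevant coordinates and splicing of points.

Ignores : {B : Set ℓb} → Fin n → (Cube r n → B) → Set ℓb
Ignores i F = ∀ x c → F (x [ i ]≔ c) ≡ F x

-- Turns `x` into `y` one coordinate at a time from the left; a step is either no change or a change
-- that `F` respects up to `~`.
connect : {A : Set ℓa} {_~_ : A → A → Set ℓ} → (∀ {u} → u ~ u) → (∀ {u v w} → u ~ v → v ~ w → u ~ w) →
          ∀ {n} (F : Cube r n → A) x y →
          (∀ i → lookup x i ≡ lookup y i ⊎ (∀ z c → F (z [ i ]≔ c) ~ F z)) → F x ~ F y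
connect r t F []       []       h = r
connect {_~_ = _~_} r t F (c ∷ x) (d ∷ y) h with h zero
... | inj₁ refl = connect {_~_ = _~_} (λ {u} → r {u}) t (F ∘ (c ∷_)) x y λ i → [ inj₁ , (λ g → inj₂ λ z → g (c ∷ z)) ]′ (h (suc i))
... | inj₂ g    = t (g (d ∷ x) c) (connect {_~_ = _~_} (λ {u} → r {u}) t (F ∘ (d ∷_)) x y λ i → [ inj₁ , (λ g → inj₂ λ z → g (d ∷ z)) ]′ (h (suc i)))

merge : (Fin n → Bool) → Cube r n → Cube r n → Cube r n
merge m []       []       = []
merge m (c ∷ w) (d ∷ x) = (if m zero then d else c) ∷ merge (m ∘ suc) w x

lookup-merge : ∀ (m : Fin n → Bool) (w x : Cube r n) i →
               lookup (merge m w x) i ≡ (if m i then lookup x i else lookup w i)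
lookup-merge m (c ∷ w) (d ∷ x) zero    = refl
lookup-merge m (c ∷ w) (d ∷ x) (suc i) = lookup-merge (m ∘ suc) w x i

merge-updateʳ : ∀ (m : Fin n → Bool) (w x : Cube r n) i c → m i ≡ true →
                merge m w (x [ i ]≔ c) ≡ merge m w x [ i ]≔ c
merge-updateʳ m (_ ∷ w) (_ ∷ x) zero    c e rewrite e = refl
merge-updateʳ m (_ ∷ w) (_ ∷ x) (suc i) c e = cong (_ ∷_) (merge-updateʳ (m ∘ suc) w x i c e)

merge-ignoreʳ : ∀ (m : Fin n → Bool) (w x : Cube r n) i c → m i ≡ false →
                merge m w (x [ i ]≔ c) ≡ merge m w x
merge-ignoreʳ m (_ ∷ w) (_ ∷ x) zero    c e rewrite e = refl
merge-ignoreʳ m (_ ∷ w) (_ ∷ x) (suc i) c e = cong (_ ∷_) (merge-ignoreʳ (m ∘ suc) w x i c e)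

merge-ignoreˡ : ∀ (m : Fin n → Bool) (w x : Cube r n) i c → m i ≡ true →
                merge m (w [ i ]≔ c) x ≡ merge m w x
merge-ignoreˡ m (_ ∷ w) (_ ∷ x) zero    c e rewrite e = refl
merge-ignoreˡ m (_ ∷ w) (_ ∷ x) (suc i) c e = cong (_ ∷_) (merge-ignoreˡ (m ∘ suc) w x i c e)

merge-mergeˡ : ∀ (m : Fin n → Bool) (w x y : Cube r n) → merge m (merge m w x) y ≡ merge m w y
merge-mergeˡ m []       []       []       = refl
merge-mergeˡ m (c ∷ w) (d ∷ x) (e ∷ y) with m zero
... | true  = cong (e ∷_) (merge-mergeˡ (m ∘ suc) w x y)
... | false = cong (c ∷_) (merge-mergeˡ (m ∘ suc) w x y)

maximiser : ∀ (xs : List A) (f : A → ℚ) → A → Σ A λ x → All (λ y → f y ≤ f x) xs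
maximiser []       f x₀ = x₀ , []
maximiser (y ∷ ys) f x₀ with maximiser ys f x₀
... | x , p with ≤-total (f y) (f x)
...   | inj₁ q = x , q ∷ p
...   | inj₂ q = y , ≤-refl ∷ All.map (λ r → ≤-trans r q) p

length-concatMap : ∀ (xs : List A) (h : A → List B) k → (∀ x → length (h x) ≡ k) →
                   length (concatMap h xs) ≡ length xs ℕ.* k
length-concatMap []       h k e = refl
length-concatMap (x ∷ xs) h k e = trans (length-++ (h x)) (cong₂ ℕ._+_ (e x) (length-concatMap xs h k e))

sum-≟ : ∀ {k} (c : Fin k) → sum (allFin k) (λ d → 𝟙 (does (d Fin.≟ c))) ≡ 1ℚ
sum-≟ {suc k} c = trans (cong (λ l → 𝟙 (does (zero Fin.≟ c)) + sum l (λ d → 𝟙 (does (d Fin.≟ c)))) (sym (map-tabulate {n = k} (λ i → i) suc)))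
                (trans (cong (_+_ (𝟙 (does (zero Fin.≟ c)))) (sum-map (allFin k) suc _)) (go c))
  where
  go : ∀ c → 𝟙 (does (zero Fin.≟ c)) + sum (allFin k) (λ d → 𝟙 (does (suc d Fin.≟ c))) ≡ 1ℚ
  go zero    = trans (cong (_+_ 1ℚ) (sum-0 (allFin k))) (+-identityʳ 1ℚ)
  go (suc c) = trans (+-identityˡ _) (sum-≟ c)

-- Expectation over the uniform cube.

module Expectation (s₀ : ℕ) where

  s : ℕ
  s = suc s₀

  opaque
    σ : ℚ
    σ = (+ 1) / s

    ιs*σ : ι s * σ ≡ 1ℚ
    ιs*σ = ι*1/ s

    0<σ : 0ℚ < σ
    0<σ = positive⁻¹ σ {{normalize-pos 1 s}}

    fins : List (Fin s)
    fins = allFin s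

    length-fins : length fins ≡ s
    length-fins = length-tabulate {n = s} (λ i → i)

    ∈-fins : ∀ c → c ∈ fins
    ∈-fins = ∈-allFin

    sum-fins-≟ : ∀ c → sum fins (λ d → 𝟙 (does (d Fin.≟ c))) ≡ 1ℚ
    sum-fins-≟ c = sum-≟ c

  0≤σ : 0ℚ ≤ σ
  0≤σ = <⇒≤ 0<σ

  σ≤1 : σ ≤ 1ℚ
  σ≤1 = ≤-by (ι s₀ * σ) (0≤* (0≤ι s₀) 0≤σ) (trans (sym ιs*σ) (lem (ι s₀) σ))
    where
    lem : ∀ a b → (1ℚ + a) * b ≡ b + a * b
    lem = solve-∀ ℚ-ring

  ιs^*σ^ : ∀ k → ι s ^ k * σ ^ k ≡ 1ℚ
  ιs^*σ^ zero    = *-identityʳ 1ℚ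
  ιs^*σ^ (suc k) = trans (lem (ι s) (ι s ^ k) σ (σ ^ k)) (trans (cong₂ _*_ ιs*σ (ιs^*σ^ k)) (*-identityʳ 1ℚ))
    where
    lem : ∀ a b c d → a * b * (c * d) ≡ (a * c) * (b * d)
    lem = solve-∀ ℚ-ring

  cube : ∀ n → List (Cube s n)
  cube zero    = [] ∷ []
  cube (suc n) = concatMap (λ c → map (c ∷_) (cube n)) fins

  length-cube : ∀ n → length (cube n) ≡ s ℕ.^ n
  length-cube zero    = refl
  length-cube (suc n) = trans (length-concatMap fins (λ c → map (c ∷_) (cube n)) _ λ c → trans (length-map (c ∷_) (cube n)) (length-cube n))
                              (cong (ℕ._* s ℕ.^ n) length-fins)

  opaque
    avg : (Fin s → ℚ) → ℚ
    avg h = σ * sum fins h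

    E : (Cube s n → ℚ) → ℚ
    E {n} F = σ ^ n * sum (cube n) F

  opaque
    unfolding avg E

    avg-cong : ∀ {g h} → (∀ c → g c ≡ h c) → avg g ≡ avg h
    avg-cong e = cong (_*_ σ) (sum-cong fins e)

    avg-const : ∀ k → avg (λ _ → k) ≡ k
    avg-const k = begin
      σ * sum fins (λ _ → k)      ≡⟨ cong (_*_ σ) (sum-const fins k) ⟩
      σ * (ι (length fins) * k)   ≡⟨ cong (λ l → σ * (ι l * k)) length-fins ⟩
      σ * (ι s * k)                     ≡⟨ lem σ (ι s) k ⟩
      (ι s * σ) * k                     ≡⟨ cong (_* k) ιs*σ ⟩
      1ℚ * k                            ≡⟨ *-identityˡ k ⟩
      k ∎
      where
      open ≡-Reasoning
      lem : ∀ a b c → a * (b * c) ≡ b * a * c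
      lem = solve-∀ ℚ-ring

    avg-* : ∀ k h → avg (λ c → k * h c) ≡ k * avg h
    avg-* k h = trans (cong (_*_ σ) (sum-* fins k h)) (lem σ k _)
      where
      lem : ∀ a b c → a * (b * c) ≡ b * (a * c)
      lem = solve-∀ ℚ-ring

    avg-swap : ∀ (h : Fin s → Fin s → ℚ) → avg (λ c → avg (h c)) ≡ avg (λ d → avg (λ c → h c d))
    avg-swap h = cong (_*_ σ) (begin
      sum fins (λ c → σ * sum fins (h c))           ≡⟨ sum-* fins σ _ ⟩
      σ * sum fins (λ c → sum fins (h c))           ≡⟨ cong (_*_ σ) (sum-swap fins fins h) ⟩
      σ * sum fins (λ d → sum fins (λ c → h c d))   ≡⟨ sum-* fins σ _ ⟨
      sum fins (λ d → σ * sum fins (λ c → h c d))   ∎)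
      where open ≡-Reasoning

    E-cong : ∀ {F H : Cube s n → ℚ} → (∀ x → F x ≡ H x) → E F ≡ E H
    E-cong {n} e = cong (_*_ (σ ^ n)) (sum-cong (cube n) e)

    E-mono : ∀ {F H : Cube s n → ℚ} → (∀ x → F x ≤ H x) → E F ≤ E H
    E-mono {n} p = *-mono-≤ˡ (σ ^ n) (0≤^ n 0≤σ) (sum-mono (cube n) p)

    E-≥0 : ∀ {F : Cube s n → ℚ} → (∀ x → 0ℚ ≤ F x) → 0ℚ ≤ E F
    E-≥0 {n} p = 0≤* (0≤^ n 0≤σ) (sum-≥0 (cube n) p)

    E-+ : ∀ (F H : Cube s n → ℚ) → E (λ x → F x + H x) ≡ E F + E H
    E-+ {n} F H = trans (cong (_*_ (σ ^ n)) (sum-+ (cube n) F H)) (*-distribˡ-+ (σ ^ n) _ _)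

    E-* : ∀ k (F : Cube s n → ℚ) → E (λ x → k * F x) ≡ k * E F
    E-* {n} k F = trans (cong (_*_ (σ ^ n)) (sum-* (cube n) k F)) (lem (σ ^ n) k _)
      where
      lem : ∀ a b c → a * (b * c) ≡ b * (a * c)
      lem = solve-∀ ℚ-ring

    E-const : ∀ k → E {n} (λ _ → k) ≡ k
    E-const {n} k = begin
      σ ^ n * sum (cube n) (λ _ → k)    ≡⟨ cong (_*_ (σ ^ n)) (sum-const (cube n) k) ⟩
      σ ^ n * (ι (length (cube n)) * k) ≡⟨ cong (λ l → σ ^ n * (l * k)) (trans (cong ι (length-cube n)) (ι-^ s n)) ⟩
      σ ^ n * (ι s ^ n * k)             ≡⟨ lem (σ ^ n) (ι s ^ n) k ⟩
      ι s ^ n * σ ^ n * k               ≡⟨ cong (_* k) (ιs^*σ^ n) ⟩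
      1ℚ * k                            ≡⟨ *-identityˡ k ⟩
      k ∎
      where
      open ≡-Reasoning
      lem : ∀ a b c → a * (b * c) ≡ b * a * c
      lem = solve-∀ ℚ-ring

    E-sum : ∀ (xs : List A) (F : A → Cube s n → ℚ) → E (λ x → sum xs (λ i → F i x)) ≡ sum xs (λ i → E (F i))
    E-sum {n = n} xs F = trans (cong (_*_ (σ ^ n)) (sum-swap (cube n) xs (λ x i → F i x))) (sym (sum-* xs (σ ^ n) _))

    -- A maximum is at least the mean. This later fixes random coordinates without loss.
    E-attained : ∀ (F : Cube s n → ℚ) → ∃ λ z → E F ≤ F z
    E-attained {n} F with maximiser (cube n) F (Vec.replicate n zero)
    ... | z , p = z , ≤-trans (*-mono-≤ˡ (σ ^ n) (0≤^ n 0≤σ) (sum-mono-All p)) (≤-reflexive (E-const {n} (F z)))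

    E-suc : ∀ (F : Cube s (suc n) → ℚ) → E F ≡ avg (λ c → E (F ∘ (c ∷_)))
    E-suc {n} F = begin
      σ * σ ^ n * sum (cube (suc n)) F                                        ≡⟨ cong (_*_ (σ * σ ^ n)) (sum-concatMap fins (λ c → map (c ∷_) (cube n)) F) ⟩
      σ * σ ^ n * sum fins (λ c → sum (map (c ∷_) (cube n)) F)          ≡⟨ cong (_*_ (σ * σ ^ n)) (sum-cong fins λ c → sum-map (cube n) (c ∷_) F) ⟩
      σ * σ ^ n * sum fins (λ c → sum (cube n) (F ∘ (c ∷_)))            ≡⟨ *-assoc σ (σ ^ n) _ ⟩
      σ * (σ ^ n * sum fins (λ c → sum (cube n) (F ∘ (c ∷_))))          ≡⟨ cong (_*_ σ) (sum-* fins (σ ^ n) _) ⟨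
      avg (λ c → E (F ∘ (c ∷_))) ∎
      where open ≡-Reasoning

    E-zero : ∀ (F : Cube s zero → ℚ) → E F ≡ F []
    E-zero F = lem (F [])
      where
      lem : ∀ a → 1ℚ * (a + 0ℚ) ≡ a
      lem = solve-∀ ℚ-ring

    avg-def : ∀ h → avg h ≡ σ * sum fins h
    avg-def h = refl

  E-minus : ∀ (F H : Cube s n → ℚ) → E (λ x → F x - H x) ≡ E F - E H
  E-minus F H = begin
    E (λ x → F x - H x)              ≡⟨ E-cong (λ x → cong (_+_ (F x)) (lem (H x))) ⟩
    E (λ x → F x + - 1ℚ * H x)       ≡⟨ E-+ F _ ⟩
    E F + E (λ x → - 1ℚ * H x)       ≡⟨ cong (_+_ (E F)) (E-* (- 1ℚ) H) ⟩
    E F + - 1ℚ * E H                 ≡⟨ cong (_+_ (E F)) (lem (E H)) ⟨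
    E F - E H ∎
    where
    open ≡-Reasoning
    lem : ∀ a → - a ≡ - 1ℚ * a
    lem a = trans (cong -_ (sym (*-identityˡ a))) (neg-distribˡ-* 1ℚ a)

  E-avg : ∀ (F : Fin s → Cube s n → ℚ) → E (λ x → avg (λ c → F c x)) ≡ avg (λ c → E (F c))
  E-avg F = trans (E-cong λ x → avg-def _) (trans (E-* σ _) (trans (cong (_*_ σ) (E-sum fins F)) (sym (avg-def _))))

  -- Fubini in one coordinate: overwriting coordinate `i` of a uniform point by a uniform letter
  -- leaves it uniform.
  E-slice : ∀ (i : Fin n) (F : Cube s n → ℚ) → E F ≡ avg (λ c → E (λ x → F (x [ i ]≔ c)))
  E-slice {suc n} zero F = trans (E-suc F) (avg-cong λ c → sym (trans (E-suc _) (avg-const _)))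
  E-slice {suc n} (suc i) F = begin
    E F                                                                ≡⟨ E-suc F ⟩
    avg (λ c → E (F ∘ (c ∷_)))                                         ≡⟨ avg-cong (λ c → E-slice i (F ∘ (c ∷_))) ⟩
    avg (λ c → avg (λ d → E (λ x → F (c ∷ x [ i ]≔ d))))               ≡⟨ avg-swap _ ⟩
    avg (λ d → avg (λ c → E (λ x → F (c ∷ x [ i ]≔ d))))               ≡⟨ avg-cong (λ d → E-suc (λ x → F (x [ suc i ]≔ d))) ⟨
    avg (λ d → E (λ x → F (x [ suc i ]≔ d))) ∎
    where open ≡-Reasoning

  -- Splicing two independent uniform points along a mask gives a uniform point. This serves as
  -- conditioning: `w` fixes the unmasked coordinates, while `x` resamples the masked ones.
  E-merge : ∀ (m : Fin n → Bool) (F : Cube s n → ℚ) → E F ≡ E (λ w → E (λ x → F (merge m w x)))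
  E-merge {zero} m F = sym (trans (E-zero _) (E-cong λ { [] → refl }))
  E-merge {suc n} m F = begin
    E F                                                                                              ≡⟨ E-suc F ⟩
    avg (λ c → E (F ∘ (c ∷_)))                                                                       ≡⟨ avg-cong (λ c → E-merge (m ∘ suc) (F ∘ (c ∷_))) ⟩
    avg (λ c → E (λ w → E (λ x → F (c ∷ merge (m ∘ suc) w x))))                                      ≡⟨ lem (m zero) ⟩
    avg (λ c → avg (λ d → E (λ w → E (λ x → F ((if m zero then d else c) ∷ merge (m ∘ suc) w x)))))  ≡⟨ avg-cong (λ c → E-avg _) ⟨
    avg (λ c → E (λ w → avg (λ d → E (λ x → F ((if m zero then d else c) ∷ merge (m ∘ suc) w x)))))  ≡⟨ avg-cong (λ c → E-cong λ w → E-suc (λ x → F (merge m (c ∷ w) x))) ⟨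
    avg (λ c → E (λ w → E (λ x → F (merge m (c ∷ w) x))))                                            ≡⟨ E-suc (λ w → E (λ x → F (merge m w x))) ⟨
    E (λ w → E (λ x → F (merge m w x))) ∎
    where
    open ≡-Reasoning
    lem : ∀ b → avg (λ c → E (λ w → E (λ x → F (c ∷ merge (m ∘ suc) w x)))) ≡
                avg (λ c → avg (λ d → E (λ w → E (λ x → F ((if b then d else c) ∷ merge (m ∘ suc) w x)))))
    lem true  = sym (avg-const _)
    lem false = avg-cong λ c → sym (avg-const _)

  merge-flip : ∀ (m : Fin n → Bool) (w x : Cube s n) → merge (not ∘ m) x w ≡ merge m w x
  merge-flip m []       []       = refl
  merge-flip m (c ∷ w) (d ∷ x) with m zero
  ... | true  = cong (d ∷_) (merge-flip (m ∘ suc) w x)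
  ... | false = cong (c ∷_) (merge-flip (m ∘ suc) w x)

  E-merge′ : ∀ (m : Fin n → Bool) (F : Cube s n → ℚ) → E F ≡ E (λ x → E (λ w → F (merge m w x)))
  E-merge′ m F = trans (E-merge (not ∘ m) F) (E-cong λ x → E-cong λ w → cong F (merge-flip m w x))

  -- At each coordinate one of the two factors is constant, so it can be pulled out of the average
  -- over that coordinate.
  E-independent : ∀ (F H : Cube s n → ℚ) → (∀ i → Ignores i F ⊎ Ignores i H) →
                  E (λ x → F x * H x) ≡ E F * E H
  E-independent {zero} F H h = trans (E-zero _) (sym (cong₂ _*_ (E-zero F) (E-zero H)))
  E-independent {suc n} F H h = begin
    E (λ x → F x * H x)                                ≡⟨ E-suc _ ⟩
    avg (λ c → E (λ x → F (c ∷ x) * H (c ∷ x)))        ≡⟨ avg-cong (λ c → E-independent (F ∘ (c ∷_)) (H ∘ (c ∷_)) (h′ c)) ⟩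
    avg (λ c → E (F ∘ (c ∷_)) * E (H ∘ (c ∷_)))        ≡⟨ split (h zero) ⟩
    avg (λ c → E (F ∘ (c ∷_))) * avg (λ c → E (H ∘ (c ∷_))) ≡⟨ cong₂ _*_ (E-suc F) (E-suc H) ⟨
    E F * E H ∎
    where
    open ≡-Reasoning
    h′ : ∀ c i → Ignores i (F ∘ (c ∷_)) ⊎ Ignores i (H ∘ (c ∷_))
    h′ c i = [ (λ g → inj₁ λ x → g (c ∷ x)) , (λ g → inj₂ λ x → g (c ∷ x)) ]′ (h (suc i))
    fixed : ∀ (F : Cube s (suc n) → ℚ) → Ignores zero F → ∀ c → E (F ∘ (c ∷_)) ≡ E (F ∘ (zero ∷_))
    fixed F g c = E-cong λ x → g (zero ∷ x) c
    half : ∀ (F H : Cube s (suc n) → ℚ) → Ignores zero F →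
           avg (λ c → E (F ∘ (c ∷_)) * E (H ∘ (c ∷_))) ≡ avg (λ c → E (F ∘ (c ∷_))) * avg (λ c → E (H ∘ (c ∷_)))
    half F H g = begin
      avg (λ c → E (F ∘ (c ∷_)) * E (H ∘ (c ∷_)))             ≡⟨ avg-cong (λ c → cong (_* E (H ∘ (c ∷_))) (fixed F g c)) ⟩
      avg (λ c → E (F ∘ (zero ∷_)) * E (H ∘ (c ∷_)))          ≡⟨ avg-* (E (F ∘ (zero ∷_))) (λ c → E (H ∘ (c ∷_))) ⟩
      E (F ∘ (zero ∷_)) * avg (λ c → E (H ∘ (c ∷_)))          ≡⟨ cong (_* avg (λ c → E (H ∘ (c ∷_)))) (trans (avg-cong (fixed F g)) (avg-const _)) ⟨
      avg (λ c → E (F ∘ (c ∷_))) * avg (λ c → E (H ∘ (c ∷_))) ∎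
    split : Ignores zero F ⊎ Ignores zero H →
            avg (λ c → E (F ∘ (c ∷_)) * E (H ∘ (c ∷_))) ≡ avg (λ c → E (F ∘ (c ∷_))) * avg (λ c → E (H ∘ (c ∷_)))
    split (inj₁ g) = half F H g
    split (inj₂ g) = trans (avg-cong λ c → *-comm (E (F ∘ (c ∷_))) _) (trans (half H F g) (*-comm (avg (λ c → E (H ∘ (c ∷_)))) _))

  -- The two slices are distinct terms of a nonnegative sum of `s` slices whose average is the whole
  -- expectation. Hence the support of a derivative grows by a factor of at most `s`.
  E-two-slices : ∀ (i : Fin n) (χ : Cube s n → Bool) {c d} → ¬ c ≡ d →
                 E (λ x → 𝟙 (χ (x [ i ]≔ c) ∨ χ (x [ i ]≔ d))) ≤ ι s * E (λ x → 𝟙 (χ x))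
  E-two-slices i χ {c} {d} c≢d = begin
    E (λ x → 𝟙 (χ (x [ i ]≔ c) ∨ χ (x [ i ]≔ d)))        ≤⟨ E-mono (λ x → 𝟙-∨ (χ (x [ i ]≔ c)) _) ⟩
    E (λ x → 𝟙 (χ (x [ i ]≔ c)) + 𝟙 (χ (x [ i ]≔ d)))    ≡⟨ E-+ _ _ ⟩
    slice c + slice d                                    ≤⟨ ∈₂⇒+≤sum (λ e → E-≥0 λ x → 0≤𝟙 (χ (x [ i ]≔ e))) c≢d (∈-fins c) (∈-fins d) ⟩
    sum fins slice                                 ≡⟨ *-identityˡ _ ⟨
    1ℚ * sum fins slice                            ≡⟨ cong (_* sum fins slice) ιs*σ ⟨
    ι s * σ * sum fins slice                       ≡⟨ trans (*-assoc (ι s) σ _) (cong (_*_ (ι s)) (sym (avg-def slice))) ⟩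
    ι s * avg slice                                      ≡⟨ cong (_*_ (ι s)) (E-slice i (𝟙 ∘ χ)) ⟨
    ι s * E (𝟙 ∘ χ) ∎
    where
    open ≤-Reasoning
    slice : Fin s → ℚ
    slice e = E (λ x → 𝟙 (χ (x [ i ]≔ e)))

  E-not : ∀ (χ : Cube s n → Bool) → E (λ x → 𝟙 (not (χ x))) ≡ 1ℚ - E (𝟙 ∘ χ)
  E-not {n} χ = trans (E-cong (λ x → 𝟙-not (χ x))) (trans (E-minus (λ _ → 1ℚ) (𝟙 ∘ χ)) (cong (_- E (𝟙 ∘ χ)) (E-const {n} 1ℚ)))

  E-∨ : ∀ (χ ψ : Cube s n → Bool) → E (λ x → 𝟙 (χ x ∨ ψ x)) ≤ E (𝟙 ∘ χ) + E (𝟙 ∘ ψ)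
  E-∨ χ ψ = ≤-trans (E-mono λ x → 𝟙-∨ (χ x) (ψ x)) (≤-reflexive (E-+ _ _))

  E≤1 : ∀ (χ : Cube s n → Bool) → E (𝟙 ∘ χ) ≤ 1ℚ
  E≤1 {n} χ = ≤-trans (E-mono λ x → 𝟙≤1 (χ x)) (≤-reflexive (E-const {n} 1ℚ))

  _≟ᶜ_ : ∀ (x y : Cube s n) → Bool
  x ≟ᶜ y = does (Vecₚ.≡-dec Fin._≟_ x y)

  E-point : ∀ (y : Cube s n) → E (λ x → 𝟙 (x ≟ᶜ y)) ≡ σ ^ n
  E-point {zero}  []      = E-zero _
  E-point {suc n} (c ∷ y) = begin
    E (λ x → 𝟙 (x ≟ᶜ (c ∷ y)))                                ≡⟨ E-suc {n} _ ⟩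
    avg (λ d → E (λ x → 𝟙 ((d ∷ x) ≟ᶜ (c ∷ y))))              ≡⟨ avg-cong (λ d → E-cong λ x → ∧-* (does (d Fin.≟ c)) (x ≟ᶜ y)) ⟩
    avg (λ d → E (λ x → 𝟙 (does (d Fin.≟ c)) * 𝟙 (x ≟ᶜ y)))   ≡⟨ avg-cong (λ d → E-* (𝟙 (does (d Fin.≟ c))) _) ⟩
    avg (λ d → 𝟙 (does (d Fin.≟ c)) * E (λ x → 𝟙 (x ≟ᶜ y)))   ≡⟨ avg-cong (λ d → trans (*-comm (𝟙 (does (d Fin.≟ c))) _) (cong (_* 𝟙 (does (d Fin.≟ c))) (E-point y))) ⟩
    avg (λ d → σ ^ n * 𝟙 (does (d Fin.≟ c)))                  ≡⟨ trans (avg-* (σ ^ n) (λ d → 𝟙 (does (d Fin.≟ c)))) (cong (_*_ (σ ^ n)) (avg-def _)) ⟩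
    σ ^ n * (σ * sum fins (λ d → 𝟙 (does (d Fin.≟ c)))) ≡⟨ cong (λ z → σ ^ n * (σ * z)) (sum-fins-≟ c) ⟩
    σ ^ n * (σ * 1ℚ)                                          ≡⟨ lem (σ ^ n) σ ⟩
    σ * σ ^ n ∎
    where
    open ≡-Reasoning
    ∧-* : ∀ a b → 𝟙 (a ∧ b) ≡ 𝟙 a * 𝟙 b
    ∧-* true  b = sym (*-identityˡ (𝟙 b))
    ∧-* false b = sym (*-zeroˡ (𝟙 b))
    lem : ∀ a b → a * (b * 1ℚ) ≡ b * a
    lem = solve-∀ ℚ-ring

-- Decidable membership and double negation.

_∈?_ : ∀ (u : Fin n) S → Dec (u ∈ S)
_∈?_ = DecMembership._∈?_ Fin._≟_

-- The double negation monad for `do` blocks: case distinctions on undecidable propositions are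
-- available while the final goal is stable.
_>>=_ : ¬ ¬ A → (A → ¬ ¬ B) → ¬ ¬ B
(m >>= f) k = m λ x → f x k

return : A → ¬ ¬ A
return x k = k x

-- Double negation commutes with finite quantifiers, so undecidable questions can be settled at all
-- points at once.
¬¬-∀Fin : ∀ {n} {P : Fin n → Set ℓ} → (∀ i → ¬ ¬ P i) → ¬ ¬ (∀ i → P i)
¬¬-∀Fin {n = zero}  h = return λ ()
¬¬-∀Fin {n = suc n} h = do
  p ← h zero
  q ← ¬¬-∀Fin (h ∘ suc)
  return λ { zero → p ; (suc i) → q i }

¬¬-∀Cube : ∀ {n} {P : Cube r n → Set ℓ} → (∀ x → ¬ ¬ P x) → ¬ ¬ (∀ x → P x)
¬¬-∀Cube {n = zero}  h = do
  p ← h []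
  return λ { [] → p }
¬¬-∀Cube {n = suc n} h = do
  p ← ¬¬-∀Fin λ c → ¬¬-∀Cube λ x → h (c ∷ x)
  return λ { (c ∷ x) → p c x }

¬¬-All : ∀ {P : A → Set ℓ} {xs} → All (λ x → ¬ ¬ P x) xs → ¬ ¬ All P xs
¬¬-All []       = return []
¬¬-All (p ∷ ps) = do
  q  ← p
  qs ← ¬¬-All ps
  return (q ∷ qs)

≤-stable : ∀ {p q : ℚ} → ¬ ¬ p ≤ q → p ≤ q
≤-stable {p} {q} = decidable-stable (p ≤? q)

module Variance (s₀ : ℕ) where
  open Expectation s₀

  -- In the expanded square all cross terms have mean zero, so second moments add. Both variance
  -- bounds below rest on this.
  E-square-sum : ∀ (xs : List A) (X : A → Cube s n → ℚ) → AllPairs (λ i j → E (λ x → X i x * X j x) ≡ 0ℚ) xs →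
                 E (λ x → sum xs (λ i → X i x) * sum xs (λ i → X i x)) ≡ sum xs (λ i → E (λ x → X i x * X i x))
  E-square-sum {n = n} [] X [] = E-const {n} (0ℚ * 0ℚ)
  E-square-sum (i ∷ xs) X (p ∷ ps) = begin
    E (λ x → (X i x + S x) * (X i x + S x))                              ≡⟨ E-cong (λ x → lem (X i x) (S x)) ⟩
    E (λ x → X i x * X i x + (2ℚ * (X i x * S x) + S x * S x))           ≡⟨ E-+ _ _ ⟩
    E (λ x → X i x * X i x) + E (λ x → 2ℚ * (X i x * S x) + S x * S x)   ≡⟨ cong (_+_ (E (λ x → X i x * X i x))) rest ⟩
    E (λ x → X i x * X i x) + sum xs (λ i → E (λ x → X i x * X i x)) ∎
    where
    open ≡-Reasoning
    S : _ → ℚ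
    S x = sum xs (λ i → X i x)
    lem : ∀ a b → (a + b) * (a + b) ≡ a * a + ((1ℚ + 1ℚ) * (a * b) + b * b)
    lem = solve-∀ ℚ-ring
    zeros : ∀ {ys} → All (λ j → E (λ x → X i x * X j x) ≡ 0ℚ) ys → sum ys (λ j → E (λ x → X i x * X j x)) ≡ 0ℚ
    zeros []       = refl
    zeros (e ∷ es) = trans (cong₂ _+_ e (zeros es)) (+-identityʳ 0ℚ)
    cross : E (λ x → X i x * S x) ≡ 0ℚ
    cross = trans (E-cong λ x → sym (sum-* xs (X i x) (λ j → X j x))) (trans (E-sum xs _) (zeros p))
    rest : E (λ x → 2ℚ * (X i x * S x) + S x * S x) ≡ sum xs (λ i → E (λ x → X i x * X i x))
    rest = begin
      E (λ x → 2ℚ * (X i x * S x) + S x * S x)           ≡⟨ E-+ _ _ ⟩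
      E (λ x → 2ℚ * (X i x * S x)) + E (λ x → S x * S x) ≡⟨ cong₂ _+_ (trans (E-* 2ℚ (λ x → X i x * S x)) (cong (_*_ 2ℚ) cross)) (E-square-sum xs X ps) ⟩
      2ℚ * 0ℚ + sum xs (λ i → E (λ x → X i x * X i x))   ≡⟨ +-identityˡ _ ⟩
      sum xs (λ i → E (λ x → X i x * X i x)) ∎

-- Sums of juntas, their derivatives and their minimum distance.

module Juntas {c ℓ} (G : AbelianGroup c ℓ)
              (stable : ∀ {x y} → ¬ ¬ AbelianGroup._≈_ G x y → AbelianGroup._≈_ G x y) (s₀ : ℕ) where
  open AbelianGroup G using (Carrier; _≈_; _∙_; ε; _⁻¹; ∙-cong; ∙-congˡ; ∙-congʳ; ⁻¹-cong; assoc; comm; identityˡ; inverseʳ; setoid; reflexive)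
    renaming (refl to ≈-refl; sym to ≈-sym; trans to ≈-trans)
  open AbelianGroupₚ G
  open import Relation.Binary.Reasoning.Setoid setoid
  open Expectation s₀

  infixl 6 _⊖_
  _⊖_ : Carrier → Carrier → Carrier
  x ⊖ y = x ∙ y ⁻¹

  ⊖-cong : ∀ {x y u v} → x ≈ y → u ≈ v → x ⊖ u ≈ y ⊖ v
  ⊖-cong p q = ∙-cong p (⁻¹-cong q)

  ⊖≈ε : ∀ {x y} → x ≈ y → x ⊖ y ≈ ε
  ⊖≈ε = x≈y⇒x∙y⁻¹≈ε

  ⊖≈ε⁻¹ : ∀ {x y} → x ⊖ y ≈ ε → x ≈ y
  ⊖≈ε⁻¹ {x} {y} = x∙y⁻¹≈ε⇒x≈y x y

  interchange : ∀ w x y z → (w ∙ x) ∙ (y ∙ z) ≈ (w ∙ y) ∙ (x ∙ z)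
  interchange w x y z = begin
    (w ∙ x) ∙ (y ∙ z) ≈⟨ assoc w x (y ∙ z) ⟩
    w ∙ (x ∙ (y ∙ z)) ≈⟨ ∙-congˡ (≈-trans (≈-sym (assoc x y z)) (≈-trans (∙-congʳ (comm x y)) (assoc y x z))) ⟩
    w ∙ (y ∙ (x ∙ z)) ≈⟨ assoc w y (x ∙ z) ⟨
    (w ∙ y) ∙ (x ∙ z) ∎

  ⊖-interchange : ∀ w x y z → (w ∙ x) ⊖ (y ∙ z) ≈ (w ⊖ y) ∙ (x ⊖ z)
  ⊖-interchange w x y z = ≈-trans (∙-congˡ (≈-sym (⁻¹-∙-comm y z))) (interchange w x (y ⁻¹) (z ⁻¹))

  Fn : ℕ → Set c
  Fn n = Cube s n → Carrier

  J : ℕ → Fn n → Set _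
  J {n} d = Defs.InJ G s n d

  Ign : Fin n → Fn n → Set _
  Ign i P = ∀ x c → P (x [ i ]≔ c) ≈ P x

  D : Fin n → Fin s → Fin s → Fn n → Fn n
  D i c d P x = P (x [ i ]≔ c) ⊖ P (x [ i ]≔ d)

  Vanishes : Fn n → Set _
  Vanishes P = ∀ x → P x ≈ ε

  private
    sumFns : List (Fn n) → Fn n
    sumFns = Defs.sumFns G

    IsJunta : ℕ → Fn n → Set _
    IsJunta {n} = Defs.IsJunta G s n

    sumFns-++ : ∀ (gs hs : List (Fn n)) x → sumFns (gs ++ hs) x ≈ sumFns gs x ∙ sumFns hs x
    sumFns-++ []       hs x = ≈-sym (identityˡ _)
    sumFns-++ (g ∷ gs) hs x = ≈-trans (∙-congˡ (sumFns-++ gs hs x)) (≈-sym (assoc _ _ _))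

    sumFns-neg : ∀ (gs : List (Fn n)) x → sumFns (map (λ g y → g y ⁻¹) gs) x ≈ sumFns gs x ⁻¹
    sumFns-neg []       x = ≈-sym ε⁻¹≈ε
    sumFns-neg (g ∷ gs) x = ≈-trans (∙-congˡ (sumFns-neg gs x)) (⁻¹-∙-comm _ _)

    sumFns-D : ∀ i c d (gs : List (Fn n)) x → sumFns (map (D i c d) gs) x ≈ D i c d (sumFns gs) x
    sumFns-D i c d []       x = ≈-sym (inverseʳ ε)
    sumFns-D i c d (g ∷ gs) x = ≈-trans (∙-congˡ (sumFns-D i c d gs x)) (≈-sym (⊖-interchange _ _ _ _))

    neg-junta : ∀ {d} {g : Fn n} → IsJunta d g → IsJunta d (λ y → g y ⁻¹)
    neg-junta (S , l , h) = S , l , λ x y e → ⁻¹-cong (h x y e)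

    D-junta : ∀ i c d {k} {g : Fn n} → IsJunta (suc k) g → IsJunta k (D i c d g)
    D-junta {n} i c d {k} {g} (S , l , h) with i ∈? S
    ... | yes i∈S = S′ , ℕₚ.≤-pred (ℕₚ.≤-trans (filter-notAll P? S (Any.map (λ e f → f (sym e)) i∈S)) l) ,
                    λ x y e → ⊖-cong (h _ _ (agree {x} {y} e c)) (h _ _ (agree {x} {y} e d))
      where
      P? = λ j → ¬? (j Fin.≟ i)
      S′ : List (Fin n)
      S′ = filter P? S
      agree : ∀ {x y} → (∀ j → j ∈ S′ → lookup x j ≡ lookup y j) →
              ∀ c j → j ∈ S → lookup (x [ i ]≔ c) j ≡ lookup (y [ i ]≔ c) j
      agree {x} {y} e c j j∈S with j Fin.≟ i
      ... | yes refl = trans (Vecₚ.lookup∘update j x c) (sym (Vecₚ.lookup∘update j y c))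
      ... | no j≢i   = trans (Vecₚ.lookup∘update′ j≢i x c) (trans (e j (∈-filter⁺ P? j∈S j≢i)) (sym (Vecₚ.lookup∘update′ j≢i y c)))
    ... | no i∉S = [] , z≤n , λ x y _ → ≈-trans (zeroD x) (≈-sym (zeroD y))
      where
      zeroD : ∀ x → D i c d g x ≈ ε
      zeroD x = ⊖≈ε (h _ _ λ j j∈S → let j≢i = λ { refl → i∉S j∈S } in
        trans (Vecₚ.lookup∘update′ j≢i x c) (sym (Vecₚ.lookup∘update′ j≢i x d)))

  J-⊖ : ∀ {d} {P Q : Fn n} → J d P → J d Q → J d (λ x → P x ⊖ Q x)
  J-⊖ (gs , p , e) (hs , q , f) = gs ++ map (λ h y → h y ⁻¹) hs , Allₚ.++⁺ p (Allₚ.map⁺ (All.map neg-junta q)) ,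
    λ x → ≈-trans (⊖-cong (e x) (f x)) (≈-sym (≈-trans (sumFns-++ gs _ x) (∙-congˡ (sumFns-neg hs x))))

  J-D : ∀ i c d {k} {P : Fn n} → J (suc k) P → J k (D i c d P)
  J-D i c d (gs , p , e) = map (D i c d) gs , Allₚ.map⁺ (All.map (D-junta i c d) p) ,
    λ x → ≈-trans (⊖-cong (e _) (e _)) (≈-sym (sumFns-D i c d gs x))

  J₀-const : ∀ {P : Fn n} → J 0 P → ∀ x y → P x ≈ P y
  J₀-const {n} (gs , p , e) x y = ≈-trans (e x) (≈-trans (go p) (≈-sym (e y)))
    where
    go : ∀ {gs} → All (IsJunta 0) gs → sumFns gs x ≈ sumFns gs y
    go []                   = ≈-refl
    go (([] , _ , h) ∷ ps) = ∙-cong (h x y λ _ ()) (go ps)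

  D-refl : ∀ i c (P : Fn n) → Vanishes (D i c c P)
  D-refl i c P x = inverseʳ _

  D-vanishes⇒Ign : ∀ {i} {P : Fn n} → (∀ c d → Vanishes (D i c d P)) → Ign i P
  D-vanishes⇒Ign {i = i} {P} h x c = ≈-trans (⊖≈ε⁻¹ (h c (lookup x i) x)) (reflexive (cong P (Vecₚ.[]≔-lookup x i)))

  const : ∀ {P : Fn n} → (∀ i → Ign i P) → ∀ x y → P x ≈ P y
  const {P = P} h x y = connect {_~_ = _≈_} ≈-refl ≈-trans P x y λ i → inj₂ (h i)

  -- Equality in G is not decidable, so the event P ≠ Q is handled through Boolean events containing it.
  Covers : (Cube s n → Bool) → Fn n → Fn n → Set _
  Covers χ P Q = ∀ x → ¬ P x ≈ Q x → χ x ≡ true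

  uncovered : ∀ {χ} {P Q : Fn n} → Covers χ P Q → ∀ {x} → χ x ≡ false → P x ≈ Q x
  uncovered h {x} e = stable λ ne → case (trans (sym (h x ne)) e)
    where
    case : true ≡ false → ⊥
    case ()

  -- If `P` agrees with `g` at both overwritten points, the derivative of `P` equals that of `g`,
  -- which is zero.
  covers-D : ∀ i c d {P g : Fn n} → Ign i g → ∀ {χ} → Covers χ P g →
              Covers (λ x → χ (x [ i ]≔ c) ∨ χ (x [ i ]≔ d)) (D i c d P) (λ _ → ε)
  covers-D i c d ign {χ} cov x ne with χ (x [ i ]≔ c) in p | χ (x [ i ]≔ d) in q
  ... | true  | _     = refl
  ... | false | true  = refl
  ... | false | false = ⊥-elim (ne (⊖≈ε (≈-trans (uncovered cov p) (≈-trans (ign x c) (≈-trans (≈-sym (ign x d)) (≈-sym (uncovered cov q)))))))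

  mutual
    -- A Schwartz-Zippel bound. If some coordinate is relevant, `distance-dep` applies with the zero
    -- function as `g`; otherwise `P` is a nonzero constant and `χ` holds everywhere.
    distance : ∀ d {P : Fn n} → J d P → ¬ Vanishes P → ∀ {χ} → Covers χ P (λ _ → ε) → σ ^ d ≤ E (𝟙 ∘ χ)
    distance {n} d {P} j ne {χ} cov = ≤-stable λ no-goal →
      let ign : ∀ i → Ign i P
          ign i = stable-Ign λ dep → no-goal (distance-dep d j (λ _ _ → ≈-refl) dep cov)
          all : ∀ x → χ x ≡ true
          all x = cov x λ e → ne λ y → ≈-trans (const ign y x) e
      in no-goal (≤-trans (^≤1 d 0≤σ σ≤1) (≤-reflexive (trans (sym (E-const {n} 1ℚ)) (E-cong λ x → cong 𝟙 (sym (all x))))))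
      where
      stable-Ign : ∀ {i} → ¬ ¬ Ign i P → Ign i P
      stable-Ign h x c = stable λ k → h λ g → k (g x c)

    -- Since `P` depends on `i`, some derivative at `i` does not vanish. It has lower degree, so
    -- induction bounds its support from below, and `E-two-slices` passes the bound on to `χ` at the
    -- cost of a factor `s`. Only `P` must be a junta sum, so `g` can later be a function of the
    -- core derived from an arbitrary `f`.
    distance-dep : ∀ d {P g : Fn n} {i} → J d P → Ign i g → ¬ Ign i P → ∀ {χ} → Covers χ P g → σ ^ d ≤ E (𝟙 ∘ χ)
    distance-dep zero j ign dep cov = ⊥-elim (dep λ x c → J₀-const j _ _)
    distance-dep (suc d) {P} {g} {i} j ign dep {χ} cov = ≤-stable λ no-goal →
      dep (D-vanishes⇒Ign λ c e x → stable λ k → no-goal (goal c e λ v → k (v x)))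
      where
      module _ (c e : Fin s) (nv : ¬ Vanishes (D i c e P)) where
        c≢e : ¬ c ≡ e
        c≢e refl = nv (D-refl i c P)
        χ′ : _ → Bool
        χ′ x = χ (x [ i ]≔ c) ∨ χ (x [ i ]≔ e)
        cov′ : Covers χ′ (D i c e P) (λ _ → ε)
        cov′ = covers-D i c e ign cov
        goal : σ ^ suc d ≤ E (𝟙 ∘ χ)
        goal = ≤-trans (*-mono-≤ˡ σ 0≤σ (≤-trans (distance d (J-D i c e j) nv cov′) (E-two-slices i χ c≢e)))
                 (≤-reflexive (trans (lem σ (ι s) _) (trans (cong (_* E (𝟙 ∘ χ)) ιs*σ) (*-identityˡ _))))
          where
          lem : ∀ a b c → a * (b * c) ≡ b * a * c
          lem = solve-∀ ℚ-ring

-- Anticoncentration of sums of independent terms in `G`.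

exclusive-sum≤1 : ∀ (xs : List A) (χ : A → Bool) → AllPairs (λ i j → χ i ≡ true → χ j ≡ true → ⊥) xs →
                  sum xs (𝟙 ∘ χ) ≤ 1ℚ
exclusive-sum≤1 []       χ []       = 0≤1
exclusive-sum≤1 (i ∷ xs) χ (p ∷ ps) with χ i
... | false = ≤-trans (≤-reflexive (+-identityˡ _)) (exclusive-sum≤1 xs χ ps)
... | true  = ≤-reflexive (trans (cong (_+_ 1ℚ) (zeros p)) (+-identityʳ 1ℚ))
  where
  zeros : ∀ {ys} → All (λ j → true ≡ true → χ j ≡ true → ⊥) ys → sum ys (𝟙 ∘ χ) ≡ 0ℚ
  zeros []             = refl
  zeros {j ∷ ys} (q ∷ qs) with χ j
  ... | true  = ⊥-elim (q refl refl)
  ... | false = trans (+-identityˡ _) (zeros qs)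

module LittlewoodOfford {c ℓ} (G : AbelianGroup c ℓ)
         (stable : ∀ {x y} → ¬ ¬ AbelianGroup._≈_ G x y → AbelianGroup._≈_ G x y) (s₀ : ℕ)
         (p : ℕ) (orders : Defs.OrdersExceed G p) where
  open AbelianGroup G using (Carrier; _≈_; _∙_; ε; _⁻¹; ∙-congˡ; ∙-congʳ; assoc; comm; identityˡ; identityʳ; inverseˡ; reflexive)
    renaming (refl to ≈-refl; sym to ≈-sym; trans to ≈-trans)
  open Expectation s₀
  open Juntas G stable s₀
  open AbelianGroupₚ G using (∙-cancelˡ; ∙-cancelʳ; xyx⁻¹≈y)

  private
    mult : ℕ → Carrier → Carrier
    mult = Defs.mult G

  -- Iterating `next` from `t₀` gives `m + 1` terms among `m` indices. A repetition makes a positive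
  -- multiple `k h` trivial with `k ≤ m ≤ p`, against the order of `h`.
  not-translation-closed : ∀ {m} (A : Fin m → Carrier) → Fin m → m ℕ.≤ p → ∀ {h} → ¬ h ≈ ε →
                           (∀ t → ∃ λ u → A u ≈ A t ∙ h) → ⊥
  not-translation-closed {m} A t₀ m≤p {h} h≉ε next = repeat (pigeonhole ℕₚ.≤-refl λ i → iter (toℕ i) t₀)
    where
    iter : ℕ → Fin m → Fin m
    iter zero    t = t
    iter (suc k) t = proj₁ (next (iter k t))
    iter-+ : ∀ k i t → iter (k ℕ.+ i) t ≡ iter k (iter i t)
    iter-+ zero    i t = refl
    iter-+ (suc k) i t = cong (proj₁ ∘ next) (iter-+ k i t)
    A-iter : ∀ k t → A (iter k t) ≈ A t ∙ mult k h
    A-iter zero    t = ≈-sym (identityʳ _)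
    A-iter (suc k) t = ≈-trans (proj₂ (next (iter k t))) (≈-trans (∙-congʳ (A-iter k t)) (≈-trans (assoc _ _ _) (∙-congˡ (comm _ h))))
    repeat : (∃ λ i → ∃ λ j → i Fin.< j × iter (toℕ i) t₀ ≡ iter (toℕ j) t₀) → ⊥
    repeat (i , j , i<j , e) = orders h h≉ε k (ℕₚ.m<n⇒0<n∸m i<j) k≤p kh≈ε
      where
      k = toℕ j ℕ.∸ toℕ i
      k≤p : k ℕ.≤ p
      k≤p = ℕₚ.≤-trans (ℕₚ.m∸n≤m (toℕ j) (toℕ i)) (ℕₚ.≤-trans (toℕ≤pred[n] j) m≤p)
      kh≈ε : mult k h ≈ ε
      kh≈ε = ∙-cancelˡ (A (iter (toℕ i) t₀)) _ _ (≈-trans (≈-sym (A-iter k (iter (toℕ i) t₀)))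
        (≈-trans (reflexive (cong A (trans (sym (iter-+ k (toℕ i) t₀))
          (trans (cong (λ l → iter l t₀) (ℕₚ.m∸n+n≡m (ℕₚ.<⇒≤ i<j))) (sym e))))) (≈-sym (identityʳ _))))

  -- Every atom of F has mass at most q; dually to Covers, χ is contained in the event F = c.
  Bound : Fn n → ℚ → Set _
  Bound F q = ∀ c χ → (∀ x → χ x ≡ true → F x ≈ c) → E (𝟙 ∘ χ) ≤ q

  _at_ : Fn n → Fin n → Fn n
  (F at i) x = F (x [ i ]≔ zero)

  -- A non-constant function of coordinate `i` plus a function of the other coordinates: one
  -- independent summand has been split off.
  Active : Fn n → Fin n → Set _
  Active F i = Σ (Fin s → Carrier) λ g → (∀ x c → F (x [ i ]≔ c) ≈ g c ∙ (F at i) x) × (∃ λ c → ∃ λ d → ¬ g c ≈ g d)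

  record Atom (F : Fn n) (δ : ℚ) : Set (c Level.⊔ ℓ) where
    field
      value : Carrier
      χ     : Cube s n → Bool
      sound : ∀ x → χ x ≡ true → F x ≈ value
      heavy : δ < E (𝟙 ∘ χ)
  open Atom

  Atoms : Fn n → ℚ → ℕ → Set _
  Atoms F δ m = Σ (Fin m → Atom F δ) λ A → ∀ i j → ¬ i ≡ j → ¬ value (A i) ≈ value (A j)

  atoms-≤1 : ∀ {F : Fn n} {δ m} → Atoms F δ m → ι m * δ ≤ 1ℚ
  atoms-≤1 {n} {F} {δ} {m} (A , distinct) = ≤-trans (≤-reflexive (sym (trans (sum-const (allFin m) δ) (cong (λ l → ι l * δ) (length-tabulate {n = m} (λ i → i))))))
    (≤-trans (sum-mono (allFin m) λ i → <⇒≤ (heavy (A i)))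
    (≤-trans (≤-reflexive (sym (E-sum (allFin m) λ i → 𝟙 ∘ χ (A i))))
    (≤-trans (E-mono λ x → exclusive-sum≤1 (allFin m) (λ i → χ (A i) x)
                (AllPairs.map (λ {i} {j} i≢j p q → distinct i j i≢j (≈-trans (≈-sym (sound (A i) x p)) (sound (A j) x q))) (allFin⁺ m)))
             (≤-reflexive (E-const {n} 1ℚ)))))

  -- The deficits `q - h d` are nonnegative and sum to `s` times the average deficit, so none
  -- exceeds that total.
  slice-lower : ∀ {q} (h : Fin s → ℚ) → (∀ c → h c ≤ q) → ∀ c → q - h c ≤ ι s * (q - avg h)
  slice-lower {q} h le c = ≤-trans (∈⇒≤sum {xs = fins} {f = λ d → q - h d} (λ d → ≤⇒0≤- (le d)) (∈-fins c)) (≤-reflexive (begin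
    sum fins (λ d → q - h d)                     ≡⟨ sum-cong fins (λ d → lem₀ q (h d)) ⟩
    sum fins (λ d → q + - 1ℚ * h d)              ≡⟨ sum-+ fins (λ _ → q) (λ d → - 1ℚ * h d) ⟩
    sum fins (λ _ → q) + sum fins (λ d → - 1ℚ * h d) ≡⟨ cong₂ _+_ (trans (sum-const fins q) (cong (λ l → ι l * q) length-fins)) (sum-* fins (- 1ℚ) h) ⟩
    ι s * q + - 1ℚ * sum fins h                  ≡⟨ cong (λ z → ι s * q + - 1ℚ * z) (trans (sym (*-identityˡ (sum fins h))) (cong (_* sum fins h) (sym ιs*σ))) ⟩
    ι s * q + - 1ℚ * (ι s * σ * sum fins h)      ≡⟨ lem (ι s) q σ (sum fins h) ⟩
    ι s * (q - σ * sum fins h)                   ≡⟨ cong (λ z → ι s * (q - z)) (sym (avg-def h)) ⟩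
    ι s * (q - avg h) ∎))
    where
    open ≡-Reasoning
    lem₀ : ∀ a b → a - b ≡ a + - 1ℚ * b
    lem₀ = solve-∀ ℚ-ring
    lem : ∀ a b c d → a * b + - 1ℚ * (a * c * d) ≡ a * (b - c * d)
    lem = solve-∀ ℚ-ring

  module _ {F : Fn n} {i : Fin n} (act : Active F i) where
    private
      g = proj₁ act

    slice-sound : ∀ {v} {χ : Cube s n → Bool} → (∀ x → χ x ≡ true → F x ≈ v) → ∀ c x → χ (x [ i ]≔ c) ≡ true → (F at i) x ≈ v ⊖ g c
    slice-sound {v} h c x e = ≈-trans (≈-sym (xyx⁻¹≈y (g c) _)) (∙-congʳ (≈-trans (≈-sym (proj₁ (proj₂ act) x c)) (h _ e)))

    -- The mass of an atom of `F` is an average of masses of atoms of `F at i`, so an independent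
    -- summand cannot raise the largest mass.
    bound-pull : ∀ {q} → Bound (F at i) q → Bound F q
    bound-pull {q} B v χ h = ≤-trans (≤-reflexive (trans (E-slice i (𝟙 ∘ χ)) (avg-def _)))
      (≤-trans (*-mono-≤ˡ σ 0≤σ (sum-mono fins λ c → B (v ⊖ g c) (λ x → χ (x [ i ]≔ c)) (slice-sound h c)))
      (≤-reflexive (trans (sym (avg-def _)) (avg-const q))))

    module _ {q γ : ℚ} (B : Bound (F at i) q) where
      -- An atom of `F` within `γ` of the maximum `q` averages `s` slice masses that are at most
      -- `q`; by `slice-lower` every slice is within `s γ` of `q`.
      shift : Fin s → Atom F (q - γ) → Atom (F at i) (q - ι s * γ)
      shift c A = record
        { value = value A ⊖ g c
        ; χ     = λ x → χ A (x [ i ]≔ c)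
        ; sound = slice-sound (sound A) c
        ; heavy = <-by (h c - q + ι s * (q - avg h) + ι s * (avg h - (q - γ)))
                    (subst (0ℚ <_) (lem₁ (h c) q (ι s * (q - avg h)) (ι s * (avg h - (q - γ))))
                       (+-mono-≤-< (≤⇒0≤- (slice-lower h (λ d → B (value A ⊖ g d) (λ x → χ A (x [ i ]≔ d)) (slice-sound (sound A) d)) c))
                                 (0<* (0<ι s₀) (<⇒0<- (subst (q - γ <_) (E-slice i (𝟙 ∘ χ A)) (heavy A))))))
                    (lem (h c) q (ι s) (avg h) γ)
        }
        where
        h : Fin s → ℚ
        h d = E (λ x → 𝟙 (χ A (x [ i ]≔ d)))
        lem₁ : ∀ a b c d → c - (b - a) + d ≡ a - b + c + d
        lem₁ = solve-∀ ℚ-ring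
        lem : ∀ a q s v γ → a ≡ q - s * γ + (a - q + s * (q - v) + s * (v - (q - γ)))
        lem = solve-∀ ℚ-ring

      -- The translates of the set of values by two distinct slice constants differ, so a value is gained.
      peel : ∀ {m} → suc m ℕ.≤ p → Atoms F (q - γ) (suc m) → ¬ ¬ Atoms (F at i) (q - ι s * γ) (suc (suc m))
      peel {m} m<p (A , distinct) = do
        let (_ , _ , a , b , ga≉gb) = act
        t , new ← fresh a b ga≉gb
        let A′ : Fin (suc (suc m)) → Atom (F at i) (q - ι s * γ)
            A′ = λ { zero → shift b (A t) ; (suc u) → shift a (A u) }
            distinct′ : ∀ i j → ¬ i ≡ j → ¬ value (A′ i) ≈ value (A′ j)
            distinct′ = λ { zero    zero    i≢j e → i≢j refl
                          ; zero    (suc j) i≢j e → new j e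
                          ; (suc i) zero    i≢j e → new i (≈-sym e)
                          ; (suc i) (suc j) i≢j e → distinct i j (λ { refl → i≢j refl }) (∙-cancelʳ _ _ _ e) }
        return (A′ , distinct′)
        where
        fresh : ∀ a b → ¬ g a ≈ g b → ¬ ¬ (∃ λ t → ∀ u → ¬ value (A t) ⊖ g b ≈ value (A u) ⊖ g a)
        -- If no value were gained, the set of values would be closed under translation by the
        -- nonzero element `g a ⊖ g b`.
        fresh a b ga≉gb none = ¬¬-∀Fin found λ next →
            not-translation-closed (value ∘ A) zero m<p (λ e → ga≉gb (⊖≈ε⁻¹ e)) λ t → proj₁ (next t) , move (proj₂ (next t))
          where
          found : ∀ t → ¬ ¬ (∃ λ u → value (A t) ⊖ g b ≈ value (A u) ⊖ g a)
          found t k = none (t , λ u e → k (u , e))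
          move : ∀ {x y} → x ⊖ g b ≈ y ⊖ g a → y ≈ x ∙ (g a ⊖ g b)
          move {x} {y} e = ∙-cancelʳ (g a ⁻¹) _ _ (≈-trans (≈-sym e) (≈-sym
            (≈-trans (assoc x _ _) (∙-congˡ (≈-trans (comm _ _) (≈-trans (≈-sym (assoc _ _ _)) (≈-trans (∙-congʳ (inverseˡ (g a))) (identityˡ _))))))))

  restrict : Fn n → List (Fin n) → Fn n
  restrict F []      = F
  restrict F (i ∷ I) = restrict (F at i) I

  Good : Fn n → List (Fin n) → Set _
  Good F I = AllPairs (λ i j → ¬ i ≡ j) I × All (Active F) I

  active-at : ∀ {F : Fn n} {i j} → ¬ i ≡ j → Active F j → Active (F at i) j
  active-at {F = F} {i} {j} i≢j (g , e , a , b , ne) = g , (λ x c → ≈-trans (reflexive (cong F (Vecₚ.[]≔-commutes x j i (λ e → i≢j (sym e)))))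
     (≈-trans (e _ c) (∙-congˡ (reflexive (cong F (Vecₚ.[]≔-commutes x i j i≢j)))))) , a , b , ne

  good-tail : ∀ {F : Fn n} {i I} → Good F (i ∷ I) → Good (F at i) I
  good-tail {F = F} ((p ∷ ps) , (a ∷ as)) = ps , All.zipWith (λ (i≢j , act) → active-at {F = F} i≢j act) (p , as)

  good-++ : ∀ {F : Fn n} I {I′} → Good F (I ++ I′) → Good F I × Good (restrict F I) I′
  good-++ {F = F} []      good = ([] , []) , good
  good-++ {F = F} (i ∷ I) good@((p ∷ ps) , (a ∷ as)) =
    let (ps′ , _) , good′ = good-++ {F = F at i} I (good-tail {F = F} good) in
    ((Allₚ.++⁻ˡ I p ∷ ps′) , (a ∷ Allₚ.++⁻ˡ I as)) , good′

  bound-restrict : ∀ I {F : Fn n} {q} → Good F I → Bound (restrict F I) q → Bound F q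
  bound-restrict []      good B = B
  bound-restrict (i ∷ I) {F} good@(_ , (a ∷ _)) B = bound-pull {F = F} a (bound-restrict I {F at i} (good-tail {F = F} good) B)

  -- Each coordinate gains one value and multiplies the deficit by `s`. The hypothesis on `p` keeps
  -- the number of values before every peeling at most `p`.
  peel-all : ∀ I {F : Fn n} {q γ m} → Good F I → Bound (restrict F I) q → length I ℕ.+ m ℕ.≤ p →
             Atoms F (q - γ) (suc m) → ¬ ¬ Atoms (restrict F I) (q - ι s ^ length I * γ) (suc (length I ℕ.+ m))
  peel-all [] {F} {q} {γ} {m} good B le A = return (subst (λ z → Atoms F (q - z) (suc m)) (sym (*-identityˡ γ)) A)
  peel-all (i ∷ I) {F} {q} {γ} {m} good@(_ , (a ∷ _)) B le A = do
    A′ ← peel {F = F} a {q} {γ} (bound-restrict I {F at i} (good-tail {F = F} good) B) (ℕₚ.≤-trans (s≤s (ℕₚ.m≤n+m m (length I))) le) A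
    A″ ← peel-all I {F at i} {q} {ι s * γ} (good-tail {F = F} good) B (subst (ℕ._≤ p) (sym (ℕₚ.+-suc (length I) m)) le) A′
    return (subst (λ l → Atoms (restrict F (i ∷ I)) (q - ι s ^ length (i ∷ I) * γ) (suc l)) (ℕₚ.+-suc (length I) m)
           (subst (λ z → Atoms (restrict F (i ∷ I)) (q - z) (suc (length I ℕ.+ suc m))) (lem (ι s ^ length I) (ι s) γ) A″))
    where
    lem : ∀ a b c → a * (b * c) ≡ b * a * c
    lem = solve-∀ ℚ-ring

  module _ (M₀ : ℕ) (M≤p : suc M₀ ℕ.≤ p) where
    private
      M : ℕ
      M = suc M₀
      u : ℚ
      u = recip M₀
      0<u : 0ℚ < u
      0<u = 0<recip M₀
      -- `M` peelings turn the deficit `γ` into `s^M γ = u`. As long as `q` is at least `η = 2 u`,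
      -- the resulting atoms have mass above `u`.
      γ : ℚ
      γ = σ ^ M * u
      η : ℚ
      η = 2ℚ * u

    -- After M steps there would be suc M disjoint events of mass at least u = 1/M.
    block : ∀ I {F : Fn n} {q} → Good F I → length I ≡ M → η ≤ q → Bound (restrict F I) q → Bound F (q - γ)
    block I {F} {q} good len η≤q B v χ h = ≤-stable λ ≰ →
      -- The event that violates the bound is the single atom from which the peeling starts.
      peel-all I {F} {q} {γ} {0} good B (ℕₚ.≤-trans (ℕₚ.≤-reflexive (trans (ℕₚ.+-identityʳ _) len)) M≤p) ((λ _ → record { value = v ; χ = χ ; sound = h ; heavy = ≰⇒> ≰ }) , λ { zero zero ne _ → ne refl })
      λ A → <-irrefl refl (<-≤-trans big (atoms-≤1 (subst (λ l → Atoms (restrict F I) (q - ι s ^ l * γ) (suc (l ℕ.+ 0))) len A)))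
      where
      big : 1ℚ < ι (suc (M ℕ.+ 0)) * (q - ι s ^ M * γ)
      big = <-by (u + ι (suc M) * (q - η)) (+-mono-<-≤ 0<u (0≤* (0≤ι (suc M)) (≤⇒0≤- η≤q))) (begin
        ι (suc (M ℕ.+ 0)) * (q - ι s ^ M * γ)                        ≡⟨ cong (λ l → ι (suc l) * (q - ι s ^ M * γ)) (ℕₚ.+-identityʳ M) ⟩
        (1ℚ + ι M) * (q - ι s ^ M * (σ ^ M * u))                     ≡⟨ cong (λ z → (1ℚ + ι M) * (q - z)) (trans (sym (*-assoc (ι s ^ M) (σ ^ M) u)) (trans (cong (_* u) (ιs^*σ^ M)) (*-identityˡ u))) ⟩
        (1ℚ + ι M) * (q - u)                                         ≡⟨ lem (ι M) q u ⟩
        ι M * u + (u + (1ℚ + ι M) * (q - (1ℚ + 1ℚ) * u))             ≡⟨ cong (_+ (u + (1ℚ + ι M) * (q - (1ℚ + 1ℚ) * u))) (ι*recip M₀) ⟩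
        1ℚ + (u + ι (suc M) * (q - η)) ∎)
        where
        open ≡-Reasoning
        lem : ∀ m q u → (1ℚ + m) * (q - u) ≡ m * u + (u + (1ℚ + m) * (q - (1ℚ + 1ℚ) * u))
        lem = solve-∀ ℚ-ring

    0≤γ : 0ℚ ≤ γ
    0≤γ = <⇒≤ (0<* (0<^ M 0<σ) 0<u)

    -- Every block of `M` coordinates lowers the bound by `γ` until it reaches `η`, where it stays.
    -- The invariant `η ≤ q` is what `block` asks for, which is why the start is `1 + η`.
    blocks : ∀ k I {F : Fn n} → Good F I → k ℕ.* M ℕ.≤ length I → ∃ λ q → η ≤ q × (q ≤ η ⊎ q ≤ 1ℚ + η - ι k * γ) × Bound F q
    blocks zero I good le = 1ℚ + η , ≤-by 1ℚ 0≤1 (+-comm 1ℚ η) , inj₂ (≤-reflexive (lem (1ℚ + η) γ)) ,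
        λ v χ _ → ≤-trans (E≤1 χ) (≤-by η (0≤* (0≤+ 0≤1 0≤1) (<⇒≤ 0<u)) refl)
      where
      lem : ∀ a b → a ≡ a - 0ℚ * b
      lem = solve-∀ ℚ-ring
    blocks (suc k) I {F} good le
      with good-++ {F = F} (take M I) (subst (Good F) (sym (take++drop≡id M I)) good)
    ... | good₁ , good₂ with blocks k (drop M I) good₂ (ℕₚ.≤-trans (ℕₚ.≤-trans (ℕₚ.≤-reflexive (sym (ℕₚ.m+n∸m≡n M (k ℕ.* M)))) (ℕₚ.∸-monoˡ-≤ M le)) (ℕₚ.≤-reflexive (sym (length-drop M I))))
    ...   | q , η≤q , small , B = result (block (take M I) good₁ (trans (length-take M I) (ℕₚ.m≤n⇒m⊓n≡m (ℕₚ.≤-trans (ℕₚ.m≤m+n M (k ℕ.* M)) le))) η≤q B) small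
      where
      ≤q-γ : ∀ {b} → q ≤ b + γ → q - γ ≤ b
      ≤q-γ {b} h = ≤-by (b + γ - q) (≤⇒0≤- h) (lem b γ q)
        where
        lem : ∀ b γ q → b ≡ q - γ + (b + γ - q)
        lem = solve-∀ ℚ-ring
      widen : ∀ {q q′} → q ≤ q′ → Bound F q → Bound F q′
      widen h B v χ e = ≤-trans (B v χ e) h
      result : Bound F (q - γ) → q ≤ η ⊎ q ≤ 1ℚ + η - ι k * γ → ∃ λ q → η ≤ q × (q ≤ η ⊎ q ≤ 1ℚ + η - ι (suc k) * γ) × Bound F q
      result B (inj₁ q≤η) = η , ≤-refl , inj₁ ≤-refl , widen (≤q-γ (≤-trans q≤η (≤-by γ 0≤γ refl))) B
      result B (inj₂ q≤) with ≤-total (q - γ) η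
      ... | inj₁ h = η , ≤-refl , inj₁ ≤-refl , widen h B
      ... | inj₂ h = q - γ , h , inj₂ (≤q-γ (≤-trans q≤ (≤-reflexive (lem (1ℚ + η) (ι k) γ)))) , B
        where
        lem : ∀ a b c → a - b * c ≡ a - (1ℚ + b) * c + c
        lem = solve-∀ ℚ-ring

    -- `M s^M` blocks suffice, because `M s^M γ = M u = 1` is the whole way from `1 + η` down to
    -- `η`.
    anticoncentration : ∀ I {F : Fn n} → Good F I → (M ℕ.* s ℕ.^ M) ℕ.* M ℕ.≤ length I → Bound F (2ℚ * recip M₀)
    anticoncentration I good le v χ h with blocks (M ℕ.* s ℕ.^ M) I good le
    ... | q , _ , inj₁ q≤η , B = ≤-trans (B v χ h) q≤η
    ... | q , _ , inj₂ q≤ , B = ≤-trans (B v χ h) (≤-trans q≤ (≤-reflexive (begin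
      1ℚ + η - ι (M ℕ.* s ℕ.^ M) * γ            ≡⟨ cong (λ z → 1ℚ + η - z * γ) (trans (ι-* M (s ℕ.^ M)) (cong (_*_ (ι M)) (ι-^ s M))) ⟩
      1ℚ + η - (ι M * ι s ^ M) * (σ ^ M * u)    ≡⟨ lem η (ι M) (ι s ^ M) (σ ^ M) u ⟩
      1ℚ + η - (ι M * u) * (ι s ^ M * σ ^ M)    ≡⟨ cong₂ (λ y z → 1ℚ + η - y * z) (ι*recip M₀) (ιs^*σ^ M) ⟩
      1ℚ + η - 1ℚ * 1ℚ                          ≡⟨ lem′ η ⟩
      η ∎)))
      where
      open ≡-Reasoning
      lem : ∀ e a b c d → 1ℚ + e - (a * b) * (c * d) ≡ 1ℚ + e - (a * d) * (b * c)
      lem = solve-∀ ℚ-ring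
      lem′ : ∀ a → 1ℚ + a - 1ℚ * 1ℚ ≡ a
      lem′ = solve-∀ ℚ-ring

-- Sparse junta sums have boundedly many relevant coordinates.

concatMap-length≤ : ∀ (xs : List A) (h : A → List B) k → (∀ x → length (h x) ℕ.≤ k) →
                    length (concatMap h xs) ℕ.≤ length xs ℕ.* k
concatMap-length≤ []       h k e = z≤n
concatMap-length≤ (x ∷ xs) h k e = ℕₚ.≤-trans (ℕₚ.≤-reflexive (length-++ (h x))) (ℕₚ.+-mono-≤ (e x) (concatMap-length≤ xs h k e))

∈-concatMap : ∀ {h : A → List B} {xs : List A} {x y} → x ∈ xs → y ∈ h x → y ∈ concatMap h xs
∈-concatMap {h = h} x∈xs y∈hx = ∈-concatMap⁺ h (Any.map (λ { refl → y∈hx }) x∈xs)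

AllPairs-lookup : ∀ {R : A → A → Set ℓ} {xs : List A} → AllPairs R xs → ∀ {x y} → x ∈ xs → y ∈ xs → x ≡ y ⊎ (R x y ⊎ R y x)
AllPairs-lookup (p ∷ ps) (here refl) (here refl) = inj₁ refl
AllPairs-lookup (p ∷ ps) (here refl) (there v)   = inj₂ (inj₁ (All.lookup p v))
AllPairs-lookup (p ∷ ps) (there u)   (here refl) = inj₂ (inj₂ (All.lookup p u))
AllPairs-lookup (p ∷ ps) (there u)   (there v)   = AllPairs-lookup ps u v

length-filter-sum : ∀ (xs : List A) (χ : A → Bool) → ι (length (filter (λ x → χ x Bool.≟ true) xs)) ≡ sum xs (𝟙 ∘ χ)
length-filter-sum []       χ = refl
length-filter-sum (x ∷ xs) χ with χ x
... | true  = cong (_+_ 1ℚ) (length-filter-sum xs χ)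
... | false = trans (length-filter-sum xs χ) (sym (+-identityˡ _))

square-diff≤1 : ∀ {x y} → 0ℚ ≤ x → x ≤ 1ℚ → 0ℚ ≤ y → y ≤ 1ℚ → (x - y) * (x - y) ≤ 1ℚ
square-diff≤1 {x} {y} 0≤x x≤1 0≤y y≤1 = ≤-by (((1ℚ - x) + y) * ((1ℚ - y) + x)) (0≤* (0≤+ (≤⇒0≤- x≤1) 0≤y) (0≤+ (≤⇒0≤- y≤1) 0≤x)) (lem x y)
  where
  lem : ∀ x y → 1ℚ ≡ (x - y) * (x - y) + ((1ℚ - x) + y) * ((1ℚ - y) + x)
  lem = solve-∀ ℚ-ring

module Constants (s₀ N₀ : ℕ) where
  open Expectation s₀

  -- T₀ active coordinates make every atom at most 1/(4N); among t d separated relevant coordinates, fewer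
  -- than T d are active with probability at most 1/(4N); K d bounds the number of relevant coordinates.
  N M₀ M T₀ : ℕ
  N  = suc N₀
  -- `suc M₀` reduces to `M`, and `2 / M` is `1 / (4 N)`.
  M₀ = N₀ ℕ.+ 7 ℕ.* suc N₀
  M  = 8 ℕ.* suc N₀
  T₀ = (M ℕ.* s ℕ.^ M) ℕ.* M

  e : ℚ
  e = recip N₀

  size T t K : ℕ → ℕ
  -- A coordinate together with the supports of its `s²` derivatives, each of size at most `k`.
  size k = suc (s ℕ.* (s ℕ.* k))
  T d = T₀ ℕ.+ 8 ℕ.* N ℕ.* s ℕ.^ d
  t d = 2 ℕ.* T d ℕ.* s ℕ.^ d
  K zero    = 0
  K (suc d) = t d ℕ.* (size (K d) ℕ.* size (K d))

module JuntaStructure {c ℓ} (G : AbelianGroup c ℓ)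
         (stable : ∀ {x y} → ¬ ¬ AbelianGroup._≈_ G x y → AbelianGroup._≈_ G x y) (s₀ : ℕ)
         (N₀ : ℕ) (orders : Defs.OrdersExceed G (8 ℕ.* suc N₀)) where
  open AbelianGroup G using (_≈_; _∙_; ε; ∙-cong; ∙-congˡ; ∙-congʳ; assoc; comm; identityʳ; inverseˡ; reflexive)
    renaming (refl to ≈-refl; sym to ≈-sym; trans to ≈-trans)
  open Expectation s₀
  open Variance s₀
  open Constants s₀ N₀
  open Juntas G stable s₀
  open LittlewoodOfford G stable s₀ (8 ℕ.* suc N₀) orders
  open AbelianGroupₚ G using (∙-cancelʳ)

  -- The mixed second differences in `i` and `u` vanish: the two coordinates do not interact.
  ignD : Fn n → Fin n → Fin n → Set _
  ignD P i u = ∀ c d → Ign u (D i c d P)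

  ignD-self : ∀ (P : Fn n) i → ignD P i i
  ignD-self P i c d x b = ⊖-cong (reflexive (cong P (Vecₚ.[]≔-idempotent x i))) (reflexive (cong P (Vecₚ.[]≔-idempotent x i)))

  ⊖-exchange : ∀ {w x y z} → w ⊖ x ≈ y ⊖ z → w ⊖ y ≈ x ⊖ z
  ⊖-exchange {w} {x} {y} {z} h = ∙-cancelʳ y _ _ (≈-trans (cancel w y) (≈-trans (≈-sym (cancel w x)) (≈-trans (∙-congʳ h)
      (≈-trans (assoc y _ x) (≈-trans (comm y _) (∙-congʳ (comm _ x)))))))
    where
    cancel : ∀ a b → (a ⊖ b) ∙ b ≈ a
    cancel a b = ≈-trans (assoc a _ b) (≈-trans (∙-congˡ (inverseˡ b)) (identityʳ a))

  -- Mixed second differences are symmetric. The derivative at `u` has the same value for `i = c`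
  -- and `i = d`, and exchanging the two middle terms of this equation gives the claim.
  ignD-sym : ∀ (P : Fn n) {i u} → ¬ i ≡ u → ignD P u i → ignD P i u
  ignD-sym P {i} {u} i≢u h c d x b = ⊖-exchange (≈-trans
      (⊖-cong (reflexive (cong P (Vecₚ.[]≔-commutes x u i (λ e → i≢u (sym e))))) (own c))
      (≈-trans (≈-trans (h b (lookup x u) x c) (≈-sym (h b (lookup x u) x d)))
      (≈-sym (⊖-cong (reflexive (cong P (Vecₚ.[]≔-commutes x u i (λ e → i≢u (sym e))))) (own d)))))
    where
    own : ∀ c → P (x [ i ]≔ c) ≈ P (x [ i ]≔ c [ u ]≔ lookup x u)
    own c = reflexive (cong P (sym (trans (cong ((x [ i ]≔ c) [ u ]≔_) (sym (Vecₚ.lookup∘update′ (λ e → i≢u (sym e)) x c))) (Vecₚ.[]≔-lookup (x [ i ]≔ c) u))))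

  -- The second component makes the derivatives at `i` and `j` independent; the last two keep each
  -- of them unchanged while the other coordinate moves.
  Separated : Fn n → Fin n → Fin n → Set _
  Separated P i j = ¬ i ≡ j × (∀ u → ignD P i u ⊎ ignD P j u) × ignD P i j × ignD P j i

  OnlyOn : List (Fin n) → Fn n → Set _
  OnlyOn S P = ∀ u → u ∉ S → Ign u P

  Junta : ℕ → Fn n → Set _
  Junta {n} K P = Σ (List (Fin n)) λ S → length S ℕ.≤ K × OnlyOn S P

  stable-Ign : ∀ {P : Fn n} {i} → ¬ ¬ Ign i P → Ign i P
  stable-Ign h x c = stable λ k → h λ g → k (g x c)

  -- S i c d supports the derivative D i c d P. Since second differences are symmetric, a coordinate outside
  -- ball i has a closed neighbourhood disjoint from that of i.
  module Greedy (P : Fn n) (k : ℕ) (S : Fin n → Fin s → Fin s → List (Fin n))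
                (small : ∀ i c d → length (S i c d) ℕ.≤ k) (only : ∀ i c d → OnlyOn (S i c d) (D i c d P)) where
    nbrs cl ball : Fin n → List (Fin n)
    nbrs i = concatMap (λ c → concatMap (S i c) fins) fins
    cl i   = i ∷ nbrs i
    ball i = concatMap cl (cl i)

    length-cl : ∀ i → length (cl i) ℕ.≤ size k
    length-cl i = s≤s (subst (λ l → length (nbrs i) ℕ.≤ l ℕ.* (s ℕ.* k)) length-fins
      (concatMap-length≤ fins _ (s ℕ.* k) λ c → subst (λ l → length (concatMap (S i c) fins) ℕ.≤ l ℕ.* k) length-fins
        (concatMap-length≤ fins _ k (small i c))))

    length-ball : ∀ i → length (ball i) ℕ.≤ size k ℕ.* size k
    length-ball i = ℕₚ.≤-trans (concatMap-length≤ (cl i) cl (size k) length-cl) (ℕₚ.*-monoˡ-≤ (size k) (length-cl i))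

    ∉cl : ∀ {i u} → u ∉ cl i → ignD P i u
    ∉cl u∉ c d = only _ c d _ λ u∈ → u∉ (there (∈-concatMap (∈-fins c) (∈-concatMap (∈-fins d) u∈)))

    separated : ∀ {i j} → j ∉ ball i → Separated P j i
    separated {i} {j} j∉ = j≢i , split , near (here refl) , ∉cl j∉cl
      where
      j∉cl : j ∉ cl i
      j∉cl j∈ = j∉ (∈-concatMap {h = cl} j∈ (here refl))
      j≢i : ¬ j ≡ i
      j≢i refl = j∉cl (here refl)
      -- If `j` were in `cl u`, it would be in `ball i`. So the derivatives at `u` ignore `j`, and
      -- symmetry reverses the roles.
      near : ∀ {u} → u ∈ cl i → ignD P j u
      near {u} u∈ = ignD-sym P (λ { refl → j∉cl u∈ }) (∉cl λ j∈ → j∉ (∈-concatMap u∈ j∈))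
      split : ∀ u → ignD P j u ⊎ ignD P i u
      split u with u ∈? (cl i)
      ... | yes u∈ = inj₁ (near u∈)
      ... | no u∉  = inj₂ (∉cl u∉)

    -- A relevant coordinate outside all balls extends the family; if there is none, the union of
    -- the balls contains every relevant coordinate.
    greedy : ∀ t → ¬ ¬ (Junta (t ℕ.* (size k ℕ.* size k)) P ⊎
                        Σ (List (Fin n)) λ I → length I ≡ t × All (λ i → ¬ Ign i P) I × AllPairs (Separated P) I)
    greedy zero = return (inj₂ ([] , refl , [] , []))
    greedy (suc t) = greedy t >>= λ
      { (inj₁ (S , l , o)) → return (inj₁ (S , ℕₚ.≤-trans l (ℕₚ.m≤n+m _ _) , o))
      ; (inj₂ (I , refl , dep , sep)) → do
          yes (i , i∉ , d) ← ¬¬-excluded-middle {A = ∃ λ i → i ∉ concatMap ball I × ¬ Ign i P}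
            where no none → return (inj₁ (concatMap ball I , ℕₚ.≤-trans (concatMap-length≤ I ball _ length-ball) (ℕₚ.m≤n+m _ _) ,
                                            λ u u∉ → stable-Ign λ ¬ign → none (u , u∉ , ¬ign)))
          return (inj₂ (i ∷ I , refl , d ∷ dep , All.tabulate (λ j∈ → separated λ i∈ → i∉ (∈-concatMap j∈ i∈)) ∷ sep))
      }

  -- Of many separated relevant coordinates, many are active at most points w (Chebyshev); with the other
  -- coordinates frozen at w, P is then a sum of many non-constant functions of single coordinates.
  module Spread (P : Fn n) (d : ℕ) (j : J (suc d) P) (I : List (Fin n))
                (len : length I ≡ t d)
                (dep : All (λ i → ¬ Ign i P) I) (sep : AllPairs (Separated P) I)
                (a b : Fin n → Fin s)
                (nv : ∀ i → ¬ Ign i P → ¬ Vanishes (D i (a i) (b i) P))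
                (dec : ∀ i x → Dec (D i (a i) (b i) P x ≈ ε)) where

    ψ : Fin n → Cube s n → Bool
    ψ i x = not (does (dec i x))

    ψ-true : ∀ {i x} → ψ i x ≡ true → ¬ D i (a i) (b i) P x ≈ ε
    ψ-true {i} {x} e with dec i x
    ψ-true () | yes _
    ... | no ne = ne

    ψ-covers : ∀ i → Covers (ψ i) (D i (a i) (b i) P) (λ _ → ε)
    ψ-covers i x ne with dec i x
    ... | yes v = ⊥-elim (ne v)
    ... | no _  = refl

    ψ-ignores : ∀ {i u} → ignD P i u → Ignores u (ψ i)
    ψ-ignores {i} {u} h x c with dec i x | dec i (x [ u ]≔ c)
    ... | yes _ | yes _ = refl
    ... | no _  | no _  = refl
    ... | yes v | no nv = ⊥-elim (nv (≈-trans (h _ _ x c) v))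
    ... | no nv | yes v = ⊥-elim (nv (≈-trans (≈-sym (h _ _ x c)) v))

    prob : Fin n → ℚ
    prob i = E (𝟙 ∘ ψ i)

    X : Fin n → Cube s n → ℚ
    X i x = 𝟙 (ψ i x) - prob i

    E-X : ∀ i → E (X i) ≡ 0ℚ
    E-X i = trans (E-minus (𝟙 ∘ ψ i) (λ _ → prob i)) (trans (cong (λ z → prob i - z) (E-const {n} (prob i))) (+-inverseʳ (prob i)))

    uncorrelated : ∀ {i k} → Separated P i k → E (λ x → X i x * X k x) ≡ 0ℚ
    uncorrelated {i} {k} (_ , split , _) = trans (E-independent (X i) (X k) λ u → [ (λ h → inj₁ (X-ign h)) , (λ h → inj₂ (X-ign h)) ]′ (split u))
                                                (trans (cong (_* E (X k)) (E-X i)) (*-zeroˡ (E (X k))))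
      where
      X-ign : ∀ {i u} → ignD P i u → Ignores u (X i)
      X-ign {i} h x c = cong (λ z → 𝟙 z - prob i) (ψ-ignores h x c)

    active : Cube s n → ℚ
    active x = sum I (λ i → 𝟙 (ψ i x))

    mean : ℚ
    mean = sum I prob

    deviation : ∀ x → sum I (λ i → X i x) ≡ active x - mean
    deviation x = begin
      sum I (λ i → 𝟙 (ψ i x) - prob i)                   ≡⟨ sum-cong I (λ i → lem (𝟙 (ψ i x)) (prob i)) ⟩
      sum I (λ i → 𝟙 (ψ i x) + - 1ℚ * prob i)            ≡⟨ sum-+ I (λ i → 𝟙 (ψ i x)) (λ i → - 1ℚ * prob i) ⟩
      active x + sum I (λ i → - 1ℚ * prob i)             ≡⟨ cong (_+_ (active x)) (sum-* I (- 1ℚ) prob) ⟩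
      active x + - 1ℚ * mean                             ≡⟨ lem (active x) mean ⟨
      active x - mean ∎
      where
      open ≡-Reasoning
      lem : ∀ a b → a - b ≡ a + - 1ℚ * b
      lem = solve-∀ ℚ-ring

    variance : E (λ x → (active x - mean) * (active x - mean)) ≤ ι (length I)
    variance = begin
      E (λ x → (active x - mean) * (active x - mean))                          ≡⟨ E-cong (λ x → cong₂ _*_ (deviation x) (deviation x)) ⟨
      E (λ x → sum I (λ i → X i x) * sum I (λ i → X i x))                      ≡⟨ E-square-sum I X (AllPairs.map uncorrelated sep) ⟩
      sum I (λ i → E (λ x → X i x * X i x))                                    ≤⟨ sum-mono I (λ i → ≤-trans (E-mono λ x → square-diff≤1 (0≤𝟙 (ψ i x)) (𝟙≤1 (ψ i x)) (E-≥0 λ x → 0≤𝟙 (ψ i x)) (E≤1 (ψ i))) (≤-reflexive (E-const {n} 1ℚ))) ⟩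
      sum I (λ _ → 1ℚ)                                                         ≡⟨ sum-const I 1ℚ ⟩
      ι (length I) * 1ℚ                                                        ≡⟨ *-identityʳ _ ⟩
      ι (length I) ∎
      where open ≤-Reasoning

    ι-len : ι (length I) ≡ ι 2 * ι (T d) * ι s ^ d
    ι-len = trans (cong ι len) (trans (ι-* (2 ℕ.* T d) (s ℕ.^ d)) (cong₂ _*_ (ι-* 2 (T d)) (ι-^ s d)))

    -- Each chosen derivative is a nonzero member of J_d, hence nonzero with probability at least
    -- `σ ^ d`; the factor `s^d` in `t d` compensates for this.
    mean≥ : ι 2 * ι (T d) ≤ mean
    mean≥ = ≤-trans (≤-reflexive (begin
        ι 2 * ι (T d)                                ≡⟨ *-identityʳ _ ⟨
        ι 2 * ι (T d) * 1ℚ                           ≡⟨ cong (_*_ (ι 2 * ι (T d))) (ιs^*σ^ d) ⟨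
        ι 2 * ι (T d) * (ι s ^ d * σ ^ d)            ≡⟨ *-assoc (ι 2 * ι (T d)) (ι s ^ d) (σ ^ d) ⟨
        ι 2 * ι (T d) * ι s ^ d * σ ^ d              ≡⟨ cong (_* σ ^ d) ι-len ⟨
        ι (length I) * σ ^ d                     ≡⟨ sum-const I (σ ^ d) ⟨
        sum I (λ _ → σ ^ d) ∎))
      (sum-mono-All (All.map (λ {i} ¬ign → distance d (J-D i (a i) (b i) j) (nv i ¬ign) (ψ-covers i)) dep))
      where open ≡-Reasoning

    τ : Cube s n → Bool
    τ x = does (decide-< (active x) (ι (T d)))

    -- With fewer than `T d` active coordinates and a mean of at least `2 T d`, the deviation is
    -- `T d + δ` with `δ ≥ 0`, and its square is `T² + δ (δ + 2 T)`.
    τ-square : ∀ x → ι (T d) * ι (T d) * 𝟙 (τ x) ≤ (active x - mean) * (active x - mean)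
    τ-square x with decide-< (active x) (ι (T d))
    ... | no _ = subst (_≤ (active x - mean) * (active x - mean)) (sym (*-zeroʳ (ι (T d) * ι (T d)))) (square≥0 (active x - mean))
    ... | yes lt = ≤-by (δ * (δ + ι 2 * ι (T d))) (0≤* 0≤δ (0≤+ 0≤δ (0≤* (0≤ι 2) (0≤ι (T d))))) (lem (active x) mean (ι (T d)))
      where
      δ : ℚ
      δ = mean - active x - ι (T d)
      0≤δ : 0ℚ ≤ δ
      0≤δ = subst (0ℚ ≤_) (lem mean (ι (T d)) (active x)) (0≤+ (≤⇒0≤- mean≥) (≤⇒0≤- (<⇒≤ lt)))
        where
        lem : ∀ m t a → m - (1ℚ + (1ℚ + 0ℚ)) * t + (t - a) ≡ m - a - t
        lem = solve-∀ ℚ-ring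
      lem : ∀ a m t → (a - m) * (a - m) ≡ t * t * 1ℚ + (m - a - t) * (m - a - t + (1ℚ + (1ℚ + 0ℚ)) * t)
      lem = solve-∀ ℚ-ring

    T-pos : ∃ λ T′ → T d ≡ suc T′
    T-pos = pos (ℕₚ.≤-trans (ℕₚ.m^n>0 s d) (ℕₚ.≤-trans (ℕₚ.m≤n*m (s ℕ.^ d) (8 ℕ.* N)) (ℕₚ.m≤n+m _ T₀)))
      where
      pos : ∀ {m} → 1 ℕ.≤ m → ∃ λ m′ → m ≡ suc m′
      pos (s≤s {n = m′} _) = m′ , refl

    0<T : 0ℚ < ι (T d)
    0<T = subst (λ m → 0ℚ < ι m) (sym (proj₂ T-pos)) (0<ι (proj₁ T-pos))

    chebyshev : ι (T d) * E (𝟙 ∘ τ) ≤ ι 2 * ι s ^ d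
    chebyshev = *-cancelˡ-≤-pos (ι (T d)) {{positive 0<T}} (begin
      ι (T d) * (ι (T d) * E (𝟙 ∘ τ))                            ≡⟨ *-assoc (ι (T d)) (ι (T d)) _ ⟨
      ι (T d) * ι (T d) * E (𝟙 ∘ τ)                              ≡⟨ E-* (ι (T d) * ι (T d)) (𝟙 ∘ τ) ⟨
      E (λ x → ι (T d) * ι (T d) * 𝟙 (τ x))                      ≤⟨ E-mono τ-square ⟩
      E (λ x → (active x - mean) * (active x - mean))    ≤⟨ variance ⟩
      ι (length I)                                       ≡⟨ ι-len ⟩
      ι 2 * ι (T d) * ι s ^ d                                ≡⟨ lem (ι 2) (ι (T d)) (ι s ^ d) ⟩
      ι (T d) * (ι 2 * ι s ^ d) ∎)
      where
      open ≤-Reasoning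
      lem : ∀ a b c → a * b * c ≡ b * (a * c)
      lem = solve-∀ ℚ-ring

    -- The summand `8 N s^d` of `T d` is there for this: `2 s^d / T d` is then at most `1 / (4 N)`.
    τ-small : ι 4 * E (𝟙 ∘ τ) ≤ e
    τ-small = begin
      ι 4 * Eτ                                                        ≡⟨ lem₀ (ι 4) Eτ ⟩
      (1ℚ * 1ℚ) * (ι 4 * Eτ)                                          ≡⟨ cong₂ (λ y z → (y * z) * (ι 4 * Eτ)) (ιs^*σ^ d) (ι*recip N₀) ⟨
      ((ι s ^ d * σ ^ d) * (ι N * e)) * (ι 4 * Eτ)                    ≡⟨ lem₁ (ι s ^ d) (σ ^ d) (ι N) e (ι 4) Eτ ⟩
      (σ ^ d * e * ½) * (((ι 2 * ι 4) * ι N * ι s ^ d) * Eτ)           ≤⟨ *-mono-≤ˡ (σ ^ d * e * ½) 0≤k (≤-trans (≤-by (ι T₀ * Eτ) (0≤* (0≤ι T₀) (E-≥0 λ x → 0≤𝟙 (τ x))) expand) chebyshev) ⟩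
      (σ ^ d * e * ½) * (ι 2 * ι s ^ d)                                 ≡⟨ lem₂ (σ ^ d) e (ι s ^ d) ⟩
      (ι s ^ d * σ ^ d) * e                                           ≡⟨ trans (cong (_* e) (ιs^*σ^ d)) (*-identityˡ e) ⟩
      e ∎
      where
      open ≤-Reasoning
      Eτ : ℚ
      Eτ = E (𝟙 ∘ τ)
      0≤k : 0ℚ ≤ σ ^ d * e * ½
      0≤k = 0≤* (0≤* (0≤^ d 0≤σ) (<⇒≤ (0<recip N₀))) (nonNegative⁻¹ ½)
      lem₀ : ∀ a b → a * b ≡ (1ℚ * 1ℚ) * (a * b)
      lem₀ = solve-∀ ℚ-ring
      lem₁ : ∀ a b c d f g → ((a * b) * (c * d)) * (f * g) ≡ (b * d * ½) * ((((1ℚ + (1ℚ + 0ℚ)) * f) * c * a) * g)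
      lem₁ = solve-∀ ℚ-ring
      lem₂ : ∀ a b c → (a * b * ½) * ((1ℚ + (1ℚ + 0ℚ)) * c) ≡ c * a * b
      lem₂ = solve-∀ ℚ-ring
      expand : ι (T d) * Eτ ≡ (ι 2 * ι 4) * ι N * ι s ^ d * Eτ + ι T₀ * Eτ
      expand = (trans (cong (_* Eτ) (trans (ι-+ T₀ (8 ℕ.* N ℕ.* s ℕ.^ d)) (cong (_+_ (ι T₀)) (trans (ι-* (8 ℕ.* N) (s ℕ.^ d)) (cong₂ _*_ (trans (ι-* 8 N) (cong (_* ι N) (ι-* 2 4))) (ι-^ s d)))))) (lem (ι T₀) _ Eτ))
        where
        lem : ∀ a b c → (a + b) * c ≡ b * c + a * c
        lem = solve-∀ ℚ-ring

    mask : Fin n → Bool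
    mask u = does (u ∈? I)

    on-I : ∀ {i u} → i ∈ I → u ∈ I → ignD P i u
    on-I {i} i∈ u∈ with AllPairs-lookup sep i∈ u∈
    ... | inj₁ refl                           = ignD-self P i
    ... | inj₂ (inj₁ (_ , _ , h , _)) = h
    ... | inj₂ (inj₂ (_ , _ , _ , h)) = h

    module _ (w : Cube s n) where
      F : Fn n
      F x = P (merge mask w x)

      mask-true : ∀ {u} → u ∈ I → mask u ≡ true
      mask-true {u} u∈ with u ∈? I
      ... | yes _ = refl
      ... | no u∉ = ⊥-elim (u∉ u∈)

      -- By separation a derivative at a chosen coordinate ignores all chosen coordinates, the only
      -- ones in which the two points can differ.
      D-merge : ∀ {i} → i ∈ I → ∀ c d x → D i c d P (merge mask w x) ≈ D i c d P w
      D-merge {i} i∈ c d x = connect {_~_ = _≈_} ≈-refl ≈-trans (D i c d P) (merge mask w x) w step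
        where
        step : ∀ u → lookup (merge mask w x) u ≡ lookup w u ⊎ Ign u (D i c d P)
        step u with u ∈? I | lookup-merge mask w x u
        ... | yes u∈ | _ = inj₂ (on-I i∈ u∈ c d)
        ... | no _   | e = inj₁ e

      -- Moving coordinate `i` from `zero` to `c` adds a derivative, which `D-merge` evaluates at
      -- `w`. The increments for `a i` and `b i` differ because `ψ i w` says that the derivative
      -- between them is nonzero.
      active-F : ∀ {i} → i ∈ I → ψ i w ≡ true → Active F i
      active-F {i} i∈ ψi = (λ c → D i c zero P w) , additive , a i , b i , λ same → ψ-true {i} {w} ψi (⊖≈ε (∙-cancelʳ _ _ _ same))
        where
        additive : ∀ x c → F (x [ i ]≔ c) ≈ D i c zero P w ∙ F (x [ i ]≔ zero)
        additive x c = ≈-trans (reflexive (cong P (merge-updateʳ mask w x i c (mask-true i∈))))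
          (≈-trans (≈-sym (≈-trans (assoc _ _ _) (≈-trans (∙-congˡ (inverseˡ _)) (identityʳ _))))
          (∙-cong (D-merge i∈ c zero x) (reflexive (cong P (sym (merge-updateʳ mask w x i zero (mask-true i∈)))))))

      -- Outside `χ` the value of `P` is zero. With `w` frozen this is an atom of `F`: either few
      -- coordinates are active at `w` and `τ w` pays, or `anticoncentration` applies.
      on-point : ∀ {χ} → Covers χ P (λ _ → ε) → E (λ x → 𝟙 (not (χ (merge mask w x)))) ≤ 𝟙 (τ w) + 2ℚ * recip M₀
      on-point {χ} cov with decide-< (active w) (ι (T d))
      ... | yes _ = ≤-trans (E≤1 (λ x → not (χ (merge mask w x)))) (≤-by (2ℚ * recip M₀) (0≤* (0≤+ 0≤1 0≤1) (<⇒≤ (0<recip M₀))) refl)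
      ... | no ≮ = ≤-trans (anticoncentration M₀ ℕₚ.≤-refl Iw good long ε (λ x → not (χ (merge mask w x))) λ x e → uncovered cov (not-true e)) (≤-reflexive (sym (+-identityˡ _)))
        where
        not-true : ∀ {v} → not v ≡ true → v ≡ false
        not-true {false} _ = refl
        Iw : List (Fin n)
        Iw = filter (λ i → ψ i w Bool.≟ true) I
        long : T₀ ℕ.≤ length Iw
        long = ℕₚ.≤-trans (ℕₚ.m≤m+n T₀ (8 ℕ.* N ℕ.* s ℕ.^ d)) (
                 (ι-cancel-≤ (≤-trans (≮⇒≥ ≮) (≤-reflexive (sym (length-filter-sum I (λ i → ψ i w)))))))
        good : Good F Iw
        good = AllPairsₚ.filter⁺ _ (AllPairs.map proj₁ sep) ,
               All.tabulate λ i∈ → let (i∈I , ψi) = ∈-filter⁻ (λ i → ψ i w Bool.≟ true) i∈ in active-F i∈I ψi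

    e≡ : e ≡ ι 4 * (2ℚ * recip M₀)
    e≡ = begin
      e                                           ≡⟨ *-identityˡ e ⟨
      1ℚ * e                                      ≡⟨ cong (_* e) (trans (cong (_* recip M₀) (sym (ι-* 8 N))) (ι*recip M₀)) ⟨
      ι 8 * ι N * recip M₀ * e                    ≡⟨ lem (ι 8) (ι N) (recip M₀) e ⟩
      ι 8 * recip M₀ * (ι N * e)                  ≡⟨ trans (cong (_*_ (ι 8 * recip M₀)) (ι*recip N₀)) (*-identityʳ _) ⟩
      ι 8 * recip M₀                              ≡⟨ trans (cong (_* recip M₀) (ι-* 4 2)) (*-assoc (ι 4) (ι 2) (recip M₀)) ⟩
      ι 4 * (ι 2 * recip M₀) ∎
      where
      open ≡-Reasoning
      lem : ∀ a b c d → a * b * c * d ≡ a * c * (b * d)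
      lem = solve-∀ ℚ-ring

    -- Averaging `on-point` over `w` shows that `χ` fails with probability at most `e / 2`, while
    -- the assumed bound makes it fail with probability at least `e`.
    contradiction : ∀ {χ} → Covers χ P (λ _ → ε) → ¬ E (𝟙 ∘ χ) ≤ 1ℚ - e
    contradiction {χ} cov small = <-irrefl refl (<-≤-trans lower upper)
      where
      lower : e + e < ι 4 * (1ℚ - E (𝟙 ∘ χ))
      lower = <-by (e + e + ι 4 * (1ℚ - e - E (𝟙 ∘ χ))) (+-mono-<-≤ (+-mono-< (0<recip N₀) (0<recip N₀)) (0≤* (0≤ι 4) (≤⇒0≤- small))) (lem e (E (𝟙 ∘ χ)))
        where
        lem : ∀ a b → (1ℚ + (1ℚ + (1ℚ + (1ℚ + 0ℚ)))) * (1ℚ - b) ≡ a + a + (a + a + (1ℚ + (1ℚ + (1ℚ + (1ℚ + 0ℚ)))) * (1ℚ - a - b))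
        lem = solve-∀ ℚ-ring
      upper : ι 4 * (1ℚ - E (𝟙 ∘ χ)) ≤ e + e
      upper = begin
        ι 4 * (1ℚ - E (𝟙 ∘ χ))                                          ≡⟨ cong (_*_ (ι 4)) (E-not χ) ⟨
        ι 4 * E (λ x → 𝟙 (not (χ x)))                                   ≡⟨ cong (_*_ (ι 4)) (E-merge mask (λ x → 𝟙 (not (χ x)))) ⟩
        ι 4 * E (λ w → E (λ x → 𝟙 (not (χ (merge mask w x)))))          ≤⟨ *-mono-≤ˡ (ι 4) (0≤ι 4) (E-mono λ w → on-point w cov) ⟩
        ι 4 * E (λ w → 𝟙 (τ w) + 2ℚ * recip M₀)                         ≡⟨ cong (_*_ (ι 4)) (trans (E-+ (𝟙 ∘ τ) (λ _ → 2ℚ * recip M₀)) (cong (_+_ (E (𝟙 ∘ τ))) (E-const {n} (2ℚ * recip M₀)))) ⟩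
        ι 4 * (E (𝟙 ∘ τ) + 2ℚ * recip M₀)                               ≡⟨ *-distribˡ-+ (ι 4) (E (𝟙 ∘ τ)) (2ℚ * recip M₀) ⟩
        ι 4 * E (𝟙 ∘ τ) + ι 4 * (2ℚ * recip M₀)                         ≤⟨ +-mono-≤ τ-small (≤-reflexive (sym e≡)) ⟩
        e + e ∎
        where open ≤-Reasoning

  -- The threshold is `σ^(d-1) - e`, written so that it makes sense at `d = 0`. A derivative
  -- multiplies the support by at most `s`, and `s (σ^d - e) ≤ s σ^d - e` is the threshold one
  -- degree lower, so induction bounds the supports of all derivatives.
  junta : ∀ d {P : Fn n} → J d P → ∀ {χ} → Covers χ P (λ _ → ε) → E (𝟙 ∘ χ) ≤ ι s * σ ^ d - e → ¬ ¬ Junta (K d) P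
  junta zero j cov small = return ([] , z≤n , λ u _ x c → J₀-const j _ _)
  junta {n} (suc d) {P} j {χ} cov small = do
    S ← ¬¬-∀Fin λ i → ¬¬-∀Fin λ c → ¬¬-∀Fin λ c′ → derivative i c c′
    inj₂ (I , len , dep , sep) ← Greedy.greedy P (K d) (λ i c c′ → proj₁ (S i c c′)) (λ i c c′ → proj₁ (proj₂ (S i c c′)))
                                               (λ i c c′ → proj₂ (proj₂ (S i c c′))) (t d)
      where inj₁ found → return found
    w ← ¬¬-∀Fin witness
    λ _ → Spread.contradiction P d j I len dep sep (λ i → proj₁ (w i)) (λ i → proj₁ (proj₂ (w i)))
            (λ i → proj₁ (proj₂ (proj₂ (w i)))) (λ i → proj₂ (proj₂ (proj₂ (w i)))) cov
            (≤-trans small′ (≤-by (1ℚ - σ ^ d) (≤⇒0≤- (^≤1 d 0≤σ σ≤1)) (lem₁ (σ ^ d) e)))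
    where
    lem₁ : ∀ a b → 1ℚ - b ≡ a - b + (1ℚ - a)
    lem₁ = solve-∀ ℚ-ring
    small′ : E (𝟙 ∘ χ) ≤ σ ^ d - e
    small′ = subst (λ z → E (𝟙 ∘ χ) ≤ z - e) (trans (sym (*-assoc (ι s) σ (σ ^ d))) (trans (cong (_* σ ^ d) ιs*σ) (*-identityˡ (σ ^ d)))) small
    derivative : ∀ i c c′ → ¬ ¬ Junta (K d) (D i c c′ P)
    derivative i c c′ with c Fin.≟ c′
    ... | yes refl = return ([] , z≤n , λ u _ x b → ≈-trans (D-refl i c P _) (≈-sym (D-refl i c P x)))
    ... | no c≢c′  = junta d (J-D i c c′ j) {λ x → χ (x [ i ]≔ c) ∨ χ (x [ i ]≔ c′)} (covers-D i c c′ (λ _ _ → ≈-refl) cov)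
        (≤-trans (E-two-slices i χ c≢c′) (≤-trans (*-mono-≤ˡ (ι s) (0≤ι s) small′)
          (≤-by (ι s₀ * e) (0≤* (0≤ι s₀) (<⇒≤ (0<recip N₀))) (lem (ι s₀) (σ ^ d) e))))
      where
      lem : ∀ a b c → (1ℚ + a) * b - c ≡ (1ℚ + a) * (b - c) + a * c
      lem = solve-∀ ℚ-ring
    witness : ∀ i → ¬ ¬ (Σ (Fin s) λ a → Σ (Fin s) λ b → (¬ Ign i P → ¬ Vanishes (D i a b P)) × (∀ x → Dec (D i a b P x ≈ ε)))
    witness i = do
      yes (a , b , nv) ← ¬¬-excluded-middle {A = ∃ λ a → ∃ λ b → ¬ Vanishes (D i a b P)}
        -- All derivatives at `i` vanish, so `i` is irrelevant; the default is the derivative from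
        -- `zero` to `zero`, which is zero.
        where no none → return (zero , zero , (λ ¬ign → ⊥-elim (¬ign (D-vanishes⇒Ign λ a b x → stable λ ne → none (a , b , λ v → ne (v x))))) ,
                                λ x → yes (D-refl i zero P x))
      dec ← ¬¬-∀Cube λ x → ¬¬-excluded-middle
      return (a , b , (λ _ → nv) , dec)

-- Counting list members over a core of coordinates.

length-filter-split : ∀ (xs : List A) (χ : A → Bool) →
  length (filter (λ x → χ x Bool.≟ true) xs) ℕ.+ length (filter (λ x → χ x Bool.≟ false) xs) ≡ length xs
length-filter-split []       χ = refl
length-filter-split (x ∷ xs) χ with χ x
... | true  = cong suc (length-filter-split xs χ)
... | false = trans (ℕₚ.+-suc _ _) (cong suc (length-filter-split xs χ))

-- Pigeonhole by halving: splitting at the first point leaves one part with more than `2^k`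
-- elements, where `k` points remain.
same-pattern : ∀ {X : Set ℓb} {R : A → A → Set ℓ} (pts : List X) (xs : List A) (h : A → X → Bool) → AllPairs R xs →
               2 ℕ.^ length pts ℕ.< length xs →
               ∃ λ i → ∃ λ j → i ∈ xs × j ∈ xs × R i j × All (λ p → h i p ≡ h j p) pts
same-pattern []        (i ∷ [])     h _              (s≤s ())
same-pattern []        (i ∷ j ∷ xs) h ((r ∷ _) ∷ _) lt = i , j , here refl , there (here refl) , r , []
same-pattern {A = A} {X = X} {R = R} (p ∷ pts) xs h rs lt = cases (length (part true) ℕ.≤? 2 ℕ.^ length pts)
  where
  part : Bool → List A
  part v = filter (λ i → h i p Bool.≟ v) xs
  recurse : ∀ v → 2 ℕ.^ length pts ℕ.< length (part v) →
            ∃ λ i → ∃ λ j → i ∈ xs × j ∈ xs × R i j × All (λ p → h i p ≡ h j p) (p ∷ pts)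
  recurse v lt with same-pattern pts (part v) h (AllPairsₚ.filter⁺ _ rs) lt
  ... | i , j , i∈ , j∈ , r , same =
    let (i∈′ , ei) = ∈-filter⁻ (λ i → h i p Bool.≟ v) i∈
        (j∈′ , ej) = ∈-filter⁻ (λ i → h i p Bool.≟ v) j∈
    in i , j , i∈′ , j∈′ , r , trans ei (sym ej) ∷ same
  cases : Dec (length (part true) ℕ.≤ 2 ℕ.^ length pts) → _
  cases (no ≰)   = recurse true (ℕₚ.≰⇒> ≰)
  cases (yes ≤h) = recurse false (ℕₚ.≰⇒> λ ≤h′ → ℕₚ.<⇒≱ lt
    (ℕₚ.≤-trans (ℕₚ.≤-reflexive (sym (length-filter-split xs (λ i → h i p))))
    (ℕₚ.≤-trans (ℕₚ.+-mono-≤ ≤h ≤h′) (ℕₚ.≤-reflexive (cong (2 ℕ.^ length pts ℕ.+_) (sym (ℕₚ.+-identityʳ _)))))))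

AllPairs-index : ∀ {R : A → A → Set ℓ} → (∀ {x y} → R x y → R y x) → ∀ {xs} → AllPairs R xs →
                 ∀ i j → ¬ i ≡ j → R (List.lookup xs i) (List.lookup xs j)
AllPairs-index sy (p ∷ ps) zero    zero    i≢j = ⊥-elim (i≢j refl)
AllPairs-index sy (p ∷ ps) zero    (suc j) i≢j = All.lookup p (∈-lookup j)
AllPairs-index sy (p ∷ ps) (suc i) zero    i≢j = sy (All.lookup p (∈-lookup i))
AllPairs-index sy (p ∷ ps) (suc i) (suc j) i≢j = AllPairs-index sy ps i j λ { refl → i≢j refl }

module Representatives (s₀ : ℕ) where
  open Expectation s₀

  -- Runs through all assignments to the coordinates in `C`, with `x₀` elsewhere; a repeated
  -- coordinate merely repeats points.
  representatives : Cube s n → List (Fin n) → List (Cube s n)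
  representatives x₀ []      = x₀ ∷ []
  representatives x₀ (i ∷ C) = concatMap (λ y → map (λ c → y [ i ]≔ c) fins) (representatives x₀ C)

  length-representatives : ∀ (x₀ : Cube s n) C → length (representatives x₀ C) ≡ s ℕ.^ length C
  length-representatives x₀ []      = refl
  length-representatives x₀ (i ∷ C) = trans (length-concatMap (representatives x₀ C) (λ y → map (λ c → y [ i ]≔ c) fins) s
                                              (λ y → trans (length-map (λ c → y [ i ]≔ c) fins) length-fins))
                                     (trans (cong (ℕ._* s) (length-representatives x₀ C)) (ℕₚ.*-comm _ s))

  representative : ∀ (x₀ : Cube s n) C x → ∃ λ y → y ∈ representatives x₀ C × (∀ u → u ∈ C → lookup x u ≡ lookup y u)
  representative x₀ []      x = x₀ , here refl , λ _ ()
  representative x₀ (i ∷ C) x with representative x₀ C x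
  ... | y , y∈ , agree = y [ i ]≔ lookup x i , ∈-concatMap {h = λ y → map (λ c → y [ i ]≔ c) fins} y∈ (∈-map⁺ (λ c → y [ i ]≔ c) (∈-fins (lookup x i))) , agree′
    where
    agree′ : ∀ u → u ∈ i ∷ C → lookup x u ≡ lookup (y [ i ]≔ lookup x i) u
    agree′ u u∈ with u Fin.≟ i
    agree′ u u∈         | yes refl = sym (Vecₚ.lookup∘update u y (lookup x u))
    agree′ u (here u≡i) | no u≢i = ⊥-elim (u≢i u≡i)
    agree′ u (there u∈) | no u≢i = trans (agree u u∈) (sym (Vecₚ.lookup∘update′ u≢i y (lookup x i)))

  ∈-cube : ∀ (x : Cube s n) → x ∈ cube n
  ∈-cube []      = here refl
  ∈-cube {suc n} (c ∷ x) = ∈-concatMap {h = λ c → map (c ∷_) (cube n)} (∈-fins c) (∈-map⁺ (c ∷_) (∈-cube x))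

module Bounds (s₀ N₀ : ℕ) where
  open Expectation s₀
  open Constants s₀ N₀

  -- `2 ^ (s ^ c)` counts the possible agreement sets on a core of `c` coordinates; the rest comes
  -- from the variance bound in `few`.
  coreBound : ℕ → ℕ
  coreBound c = 2 ℕ.* N ℕ.* (2 ℕ.^ (s ℕ.^ c) ℕ.+ N)

  -- The enlarged core takes in at most `coreBound c` rests of at most `suc k` coordinates each.
  listBound : ℕ → ℕ → ℕ
  listBound zero    c = coreBound c
  listBound (suc k) c = listBound k (c ℕ.+ coreBound c ℕ.* suc k)

module Lists {c ℓ} (G : AbelianGroup c ℓ)
         (stable : ∀ {x y} → ¬ ¬ AbelianGroup._≈_ G x y → AbelianGroup._≈_ G x y) (s₀ N₀ d n : ℕ)
         (f : Cube (suc s₀) n → AbelianGroup.Carrier G) where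
  open AbelianGroup G using (Carrier; _≈_; _∙_; ε; _⁻¹; ∙-cong; ⁻¹-cong; assoc; comm; identityˡ; identityʳ; inverseˡ; inverseʳ; reflexive)
    renaming (refl to ≈-refl; sym to ≈-sym; trans to ≈-trans)
  open Expectation s₀
  open Variance s₀
  open Representatives s₀
  open Constants s₀ N₀
  open Bounds s₀ N₀
  open Juntas G stable s₀

  -- A list member Q at distance at most σ ^ d - e from f, depending only on coordinates in C or rest.
  record Item (C : List (Fin n)) : Set (c Level.⊔ ℓ) where
    field
      Q     : Fn n
      inJ   : J d Q
      χ     : Cube s n → Bool
      cov   : Covers χ Q f
      close : E (𝟙 ∘ χ) ≤ σ ^ d - e
      rest  : List (Fin n)
      only  : ∀ u → u ∉ C → u ∉ rest → Ign u Q
  open Item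

  Distinct : ∀ {C} → Item C → Item C → Set _
  Distinct p q = ¬ (∀ x → Q p x ≈ Q q x)

  Disjoint : ∀ {C} → Item C → Item C → Set _
  Disjoint p q = ∀ u → u ∈ rest p → u ∉ rest q

  classes : ∀ (xs : List Carrier) → ¬ ¬ (Σ ℕ λ k → Σ (Fin k → Carrier) λ V →
              (∀ i j → ¬ i ≡ j → ¬ V i ≈ V j) × All (λ x → ∃ λ v → x ≈ V v) xs)
  classes []       = return (0 , (λ ()) , (λ ()) , [])
  classes (x ∷ xs) = do
    k , V , dist , cls ← classes xs
    no new ← ¬¬-excluded-middle {A = ∃ λ v → x ≈ V v}
      where yes old → return (k , V , dist , old ∷ cls)
    let V′ : Fin (suc k) → Carrier
        V′ = λ { zero → x ; (suc v) → V v }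
        dist′ : ∀ i j → ¬ i ≡ j → ¬ V′ i ≈ V′ j
        dist′ = λ { zero    zero    ne _ → ne refl
                  ; zero    (suc j) ne h → new (j , h)
                  ; (suc i) zero    ne h → new (i , ≈-sym h)
                  ; (suc i) (suc j) ne h → dist i j (λ { refl → ne refl }) h }
    return (suc k , V′ , dist′ , (zero , ≈-refl) ∷ All.map (λ (v , h) → suc v , h) cls)

  -- V enumerates the distinct values of f, and φ labels points by them.
  module Sunflower (C : List (Fin n)) (m₀ : ℕ) (it : Fin (suc m₀) → Item C)
                   (distinct : ∀ i j → ¬ i ≡ j → Distinct (it i) (it j))
                   (disjoint : ∀ i j → ¬ i ≡ j → Disjoint (it i) (it j))
                   (k : ℕ) (V : Fin k → Carrier) (V-distinct : ∀ i j → ¬ i ≡ j → ¬ V i ≈ V j)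
                   (φ : Cube s n → Fin k) (f≈ : ∀ x → f x ≈ V (φ x))
                   (dec : ∀ i x v → Dec (Q (it i) x ≈ V v)) where

    m : ℕ
    m = suc m₀

    ix : List (Fin m)
    ix = allFin m

    ix-length : length ix ≡ m
    ix-length = length-tabulate {n = m} (λ i → i)

    vs : List (Fin k)
    vs = allFin k

    a : Fin m → Fin k → Cube s n → Bool
    a i v x = does (dec i x v)

    a-true : ∀ {i v x} → a i v x ≡ true → Q (it i) x ≈ V v
    a-true {i} {v} {x} h with dec i x v
    ... | yes p = p

    a-intro : ∀ {i v x} → Q (it i) x ≈ V v → a i v x ≡ true
    a-intro {i} {v} {x} h with dec i x v
    ... | yes _ = refl
    ... | no ne = ⊥-elim (ne h)

    a-ignores : ∀ {i u} → Ign u (Q (it i)) → ∀ v → Ignores u (a i v)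
    a-ignores {i} {u} h v x c with dec i x v | dec i (x [ u ]≔ c) v
    ... | yes _ | yes _ = refl
    ... | no _  | no _  = refl
    ... | yes p | no np = ⊥-elim (np (≈-trans (h x c) p))
    ... | no np | yes p = ⊥-elim (np (≈-trans (≈-sym (h x c)) p))

    mask : Fin n → Bool
    mask u = not (does (u ∈? C))

    ∉C⇒mask : ∀ {u} → u ∉ C → mask u ≡ true
    ∉C⇒mask {u} u∉ with u ∈? C
    ... | yes u∈ = ⊥-elim (u∉ u∈)
    ... | no _   = refl

    -- The conditional probability that member `i` takes the value `V v`, given the coordinates of
    -- `y` in the core.
    q : Fin m → Fin k → Cube s n → ℚ
    q i v y = E (λ z → 𝟙 (a i v (merge mask y z)))

    q-merge : ∀ i v y z → q i v (merge mask y z) ≡ q i v y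
    q-merge i v y z = E-cong λ z′ → cong (𝟙 ∘ a i v) (merge-mergeˡ mask y z z′)

    0≤q : ∀ i v y → 0ℚ ≤ q i v y
    0≤q i v y = E-≥0 λ z → 0≤𝟙 (a i v (merge mask y z))

    q≤1 : ∀ i v y → q i v y ≤ 1ℚ
    q≤1 i v y = E≤1 (λ z → a i v (merge mask y z))

    X : Fin m → Fin k → Cube s n → ℚ
    X i v x = 𝟙 (a i v x) - q i v x

    separate : ∀ {i j} → ¬ i ≡ j → ∀ u → u ∉ C → Ign u (Q (it i)) ⊎ Ign u (Q (it j))
    separate {i} {j} i≢j u u∉ with u ∈? (rest (it i))
    ... | yes u∈ = inj₂ (only (it j) u u∉ (disjoint i j i≢j u u∈))
    ... | no u∉′ = inj₁ (only (it i) u u∉ u∉′)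

    -- Given the core, the two indicators depend on disjoint sets of coordinates and are
    -- independent, so the product of the centred indicators has conditional mean zero.
    uncorrelated : ∀ v {i j} → ¬ i ≡ j → E (λ x → X i v x * X j v x) ≡ 0ℚ
    uncorrelated v {i} {j} i≢j = trans (E-merge mask (λ x → X i v x * X j v x))
        (trans (E-cong inner) (E-const {n} 0ℚ))
      where
      module _ (y : Cube s n) where
        Y : Fin m → Cube s n → ℚ
        Y i z = 𝟙 (a i v (merge mask y z)) - q i v y
        E-Y : ∀ i → E (Y i) ≡ 0ℚ
        E-Y i = trans (E-minus _ (λ _ → q i v y)) (trans (cong (λ w → q i v y - w) (E-const {n} (q i v y))) (+-inverseʳ (q i v y)))
        Y-ign : ∀ {i u} → Ign u (Q (it i)) → mask u ≡ true → Ignores u (Y i)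
        Y-ign {i} {u} h e z c = cong (λ w → 𝟙 w - q i v y) (trans (cong (a i v) (merge-updateʳ mask y z u c e)) (a-ignores h v _ c))
        indep : ∀ u → Ignores u (Y i) ⊎ Ignores u (Y j)
        indep u with mask u in e
        ... | false = inj₁ λ z c → cong (λ w → 𝟙 (a i v w) - q i v y) (merge-ignoreʳ mask y z u c e)
        ... | true with separate i≢j u (λ u∈ → masked u∈ e)
          where
          masked : u ∈ C → ¬ mask u ≡ true
          masked u∈ with u ∈? C
          ... | yes _ = λ ()
          ... | no u∉ = λ _ → u∉ u∈
        ...   | inj₁ h = inj₁ (Y-ign h e)
        ...   | inj₂ h = inj₂ (Y-ign h e)
        inner : E (λ z → X i v (merge mask y z) * X j v (merge mask y z)) ≡ 0ℚ
        inner = trans (E-cong λ z → cong₂ (λ p r → (𝟙 (a i v (merge mask y z)) - p) * (𝟙 (a j v (merge mask y z)) - r)) (q-merge i v y z) (q-merge j v y z))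
          (trans (E-independent (Y i) (Y j) indep) (trans (cong (_* E (Y j)) (E-Y i)) (*-zeroˡ (E (Y j)))))

    E-q : ∀ i v → E (q i v) ≡ E (𝟙 ∘ a i v)
    E-q i v = sym (E-merge mask (𝟙 ∘ a i v))

    -- The bound is proportional to the probability of the value, so that summing over all values
    -- costs a constant factor and not their number `k`. It follows from `(p - r)² ≤ p + r` on the
    -- unit interval.
    E-X² : ∀ i v → E (λ x → X i v x * X i v x) ≤ 2ℚ * E (𝟙 ∘ a i v)
    E-X² i v = ≤-trans (E-mono λ x → bound (0≤𝟙 (a i v x)) (𝟙≤1 (a i v x)) (0≤q i v x) (q≤1 i v x))
      (≤-reflexive (trans (E-+ (𝟙 ∘ a i v) (q i v)) (trans (cong (_+_ (E (𝟙 ∘ a i v))) (E-q i v)) (lem (E (𝟙 ∘ a i v))))))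
      where
      lem : ∀ a → a + a ≡ (1ℚ + 1ℚ) * a
      lem = solve-∀ ℚ-ring
      bound : ∀ {p r} → 0ℚ ≤ p → p ≤ 1ℚ → 0ℚ ≤ r → r ≤ 1ℚ → (p - r) * (p - r) ≤ p + r
      bound {p} {r} 0≤p p≤1 0≤r r≤1 = ≤-by (p * (1ℚ - p) + (r * (1ℚ - r) + 2ℚ * (p * r)))
        (0≤+ (0≤* 0≤p (≤⇒0≤- p≤1)) (0≤+ (0≤* 0≤r (≤⇒0≤- r≤1)) (0≤* (0≤+ 0≤1 0≤1) (0≤* 0≤p 0≤r)))) (lem₁ p r)
        where
        lem₁ : ∀ p r → p + r ≡ (p - r) * (p - r) + (p * (1ℚ - p) + (r * (1ℚ - r) + (1ℚ + 1ℚ) * (p * r)))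
        lem₁ = solve-∀ ℚ-ring

    E-values≤1 : ∀ i → sum vs (λ v → E (𝟙 ∘ a i v)) ≤ 1ℚ
    E-values≤1 i = ≤-trans (≤-reflexive (sym (E-sum vs (λ v → 𝟙 ∘ a i v))))
      (≤-trans (E-mono λ x → exclusive-sum≤1 vs (λ v → a i v x) (AllPairs.map (λ {v} {v′} ne p r → V-distinct v v′ ne (≈-trans (≈-sym (a-true p)) (a-true r))) (allFin⁺ k)))
      (≤-reflexive (E-const {n} 1ℚ)))

    -- The number of members agreeing with `f` at `x`, minus the sum of the conditional
    -- probabilities of the value `f x`.
    W : Cube s n → ℚ
    W x = sum ix (λ i → X i (φ x) x)

    -- As `φ x` varies with `x`, `W` is not a sum of uncorrelated terms. Its square is at most the
    -- sum over all fixed values `v` of the corresponding squares, and for each `v` the terms are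
    -- uncorrelated.
    second-moment : E (λ x → W x * W x) ≤ 2ℚ * ι m
    second-moment = begin
      E (λ x → W x * W x)                                                              ≤⟨ E-mono (λ x → ∈⇒≤sum {xs = vs} {f = λ v → sum ix (λ i → X i v x) * sum ix (λ i → X i v x)} (λ v → square≥0 (sum ix (λ i → X i v x))) (∈-allFin (φ x))) ⟩
      E (λ x → sum vs (λ v → sum ix (λ i → X i v x) * sum ix (λ i → X i v x)))         ≡⟨ E-sum vs (λ v x → sum ix (λ i → X i v x) * sum ix (λ i → X i v x)) ⟩
      sum vs (λ v → E (λ x → sum ix (λ i → X i v x) * sum ix (λ i → X i v x)))         ≡⟨ sum-cong vs (λ v → E-square-sum ix (λ i → X i v) (AllPairs.map (uncorrelated v) (allFin⁺ m))) ⟩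
      sum vs (λ v → sum ix (λ i → E (λ x → X i v x * X i v x)))                        ≤⟨ sum-mono vs (λ v → sum-mono ix λ i → E-X² i v) ⟩
      sum vs (λ v → sum ix (λ i → 2ℚ * E (𝟙 ∘ a i v)))                                 ≡⟨ sum-swap vs ix (λ v i → 2ℚ * E (𝟙 ∘ a i v)) ⟩
      sum ix (λ i → sum vs (λ v → 2ℚ * E (𝟙 ∘ a i v)))                                 ≡⟨ sum-cong ix (λ i → sum-* vs 2ℚ (λ v → E (𝟙 ∘ a i v))) ⟩
      sum ix (λ i → 2ℚ * sum vs (λ v → E (𝟙 ∘ a i v)))                                 ≡⟨ sum-* ix 2ℚ (λ i → sum vs (λ v → E (𝟙 ∘ a i v))) ⟩
      2ℚ * sum ix (λ i → sum vs (λ v → E (𝟙 ∘ a i v)))                                 ≤⟨ *-mono-≤ˡ 2ℚ (0≤+ 0≤1 0≤1) (sum-mono ix E-values≤1) ⟩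
      2ℚ * sum ix (λ _ → 1ℚ)                                                           ≡⟨ cong (_*_ 2ℚ) (trans (sum-const ix 1ℚ) (trans (*-identityʳ (ι (length ix))) (cong ι ix-length))) ⟩
      2ℚ * ι m ∎
      where open ≤-Reasoning

    -- 2 (m e) W ≤ (m e)² + W², averaged and divided by m e.
    E-W : 2ℚ * E W ≤ ι m * e + 2ℚ * ι N
    E-W = begin
      2ℚ * E W                                   ≡⟨ trans (sym (*-identityˡ (2ℚ * E W))) (cong (_* (2ℚ * E W)) (sym (ι*recip N₀))) ⟩
      ι N * e * (2ℚ * E W)                       ≡⟨ lem₁ (ι N) e (E W) ⟩
      ι N * (2ℚ * e * E W)                       ≤⟨ *-mono-≤ˡ (ι N) (0≤ι N) (*-cancelˡ-≤-pos (ι m) {{positive (0<ι m₀)}} cancelled) ⟩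
      ι N * (ι m * (e * e) + 2ℚ)                 ≡⟨ lem₂ (ι N) (ι m) e ⟩
      ι m * e * (ι N * e) + 2ℚ * ι N             ≡⟨ cong (λ z → z + 2ℚ * ι N) (trans (cong (_*_ (ι m * e)) (ι*recip N₀)) (*-identityʳ (ι m * e))) ⟩
      ι m * e + 2ℚ * ι N ∎
      where
      open ≤-Reasoning
      lem₁ : ∀ a b c → a * b * ((1ℚ + 1ℚ) * c) ≡ a * ((1ℚ + 1ℚ) * b * c)
      lem₁ = solve-∀ ℚ-ring
      lem₂ : ∀ a b c → a * (b * (c * c) + (1ℚ + 1ℚ)) ≡ b * c * (a * c) + (1ℚ + 1ℚ) * a
      lem₂ = solve-∀ ℚ-ring
      amgm : ∀ x → 2ℚ * (ι m * e) * W x ≤ ι m * e * (ι m * e) + W x * W x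
      amgm x = ≤-by ((ι m * e - W x) * (ι m * e - W x)) (square≥0 (ι m * e - W x)) (lem (ι m * e) (W x))
        where
        lem : ∀ a b → a * a + b * b ≡ (1ℚ + 1ℚ) * a * b + (a - b) * (a - b)
        lem = solve-∀ ℚ-ring
      cancelled : ι m * (2ℚ * e * E W) ≤ ι m * (ι m * (e * e) + 2ℚ)
      cancelled = begin
        ι m * (2ℚ * e * E W)                                        ≡⟨ lem (ι m) e (E W) ⟩
        2ℚ * (ι m * e) * E W                                        ≡⟨ E-* (2ℚ * (ι m * e)) W ⟨
        E (λ x → 2ℚ * (ι m * e) * W x)                              ≤⟨ E-mono amgm ⟩
        E (λ x → ι m * e * (ι m * e) + W x * W x)                   ≡⟨ trans (E-+ (λ _ → ι m * e * (ι m * e)) (λ x → W x * W x)) (cong (_+ E (λ x → W x * W x)) (E-const {n} (ι m * e * (ι m * e)))) ⟩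
        ι m * e * (ι m * e) + E (λ x → W x * W x)                   ≤⟨ +-monoʳ-≤ (ι m * e * (ι m * e)) second-moment ⟩
        ι m * e * (ι m * e) + 2ℚ * ι m                              ≡⟨ lem′ (ι m) e ⟩
        ι m * (ι m * (e * e) + 2ℚ) ∎
        where
        lem : ∀ a b c → a * ((1ℚ + 1ℚ) * b * c) ≡ (1ℚ + 1ℚ) * (a * b) * c
        lem = solve-∀ ℚ-ring
        lem′ : ∀ a b → a * b * (a * b) + (1ℚ + 1ℚ) * a ≡ a * (a * (b * b) + (1ℚ + 1ℚ))
        lem′ = solve-∀ ℚ-ring

    R : Cube s n → ℚ
    R x = sum ix (λ i → q i (φ x) x)

    -- Each member agrees with `f` with probability at least `1 - σ^d + e`; every agreement
    -- indicator is its centred part plus a conditional probability.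
    agreement : ι m * (1ℚ - σ ^ d + e) ≤ E W + E R
    agreement = begin
      ι m * (1ℚ - σ ^ d + e)                                      ≡⟨ trans (sum-const ix (1ℚ - σ ^ d + e)) (cong (λ l → ι l * (1ℚ - σ ^ d + e)) ix-length) ⟨
      sum ix (λ _ → 1ℚ - σ ^ d + e)                               ≤⟨ sum-mono ix each ⟩
      sum ix (λ i → E (λ x → 𝟙 (a i (φ x) x)))                    ≡⟨ E-sum ix (λ i x → 𝟙 (a i (φ x) x)) ⟨
      E (λ x → sum ix (λ i → 𝟙 (a i (φ x) x)))                    ≡⟨ E-cong (λ x → trans (sum-cong ix λ i → lem (𝟙 (a i (φ x) x)) (q i (φ x) x)) (sum-+ ix (λ i → X i (φ x) x) (λ i → q i (φ x) x))) ⟩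
      E (λ x → W x + R x)                                         ≡⟨ E-+ W R ⟩
      E W + E R ∎
      where
      open ≤-Reasoning
      lem : ∀ a b → a ≡ a - b + b
      lem = solve-∀ ℚ-ring
      lem′ : ∀ a b c → 1ℚ - c ≡ 1ℚ - a + b + (a - b - c)
      lem′ = solve-∀ ℚ-ring
      each : ∀ i → 1ℚ - σ ^ d + e ≤ E (λ x → 𝟙 (a i (φ x) x))
      each i = ≤-trans (≤-by (σ ^ d - e - E (𝟙 ∘ χ (it i))) (≤⇒0≤- (close (it i))) (lem′ (σ ^ d) e (E (𝟙 ∘ χ (it i)))))
        (≤-trans (≤-reflexive (sym (E-not (χ (it i)))))
        (E-mono λ x → 𝟙-mono λ h → a-intro (≈-trans (uncovered (cov (it i)) (not-true h)) (f≈ x))))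
        where
        not-true : ∀ {v} → not v ≡ true → v ≡ false
        not-true {false} _ = refl

    -- Freezing the coordinates of f outside C at z₀ loses nothing on average, and makes it depend on C only.
    z₀ : Cube s n
    z₀ = proj₁ (E-attained (λ z → E (λ y → R (merge mask y z))))

    g : Cube s n → Fin k
    g y = φ (merge mask y z₀)

    h : Fin m → Cube s n → Bool
    h i x = a i (g x) x

    b : Fin m → ℚ
    b i = E (𝟙 ∘ h i)

    g-ignores : ∀ {u} → u ∉ C → Ignores u g
    g-ignores {u} u∉ x c = cong φ (merge-ignoreˡ mask x z₀ u c (∉C⇒mask u∉))

    -- Conditional probabilities see only the core part of a point, so fixing the outer part at `z₀`
    -- affects only the label of `f`. Unfolding `q` then gives the probability of agreement with
    -- `V ∘ g`.
    E-R≤ : E R ≤ sum ix b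
    E-R≤ = begin
      E R                                                 ≡⟨ E-merge′ mask R ⟩
      E (λ z → E (λ y → R (merge mask y z)))              ≤⟨ proj₂ (E-attained (λ z → E (λ y → R (merge mask y z)))) ⟩
      E (λ y → R (merge mask y z₀))                       ≡⟨ E-cong (λ y → sum-cong ix λ i → q-merge i (g y) y z₀) ⟩
      E (λ y → sum ix (λ i → q i (g y) y))                ≡⟨ E-sum ix (λ i y → q i (g y) y) ⟩
      sum ix (λ i → E (λ y → q i (g y) y))                ≡⟨ sum-cong ix (λ i → E-cong λ y → E-cong λ z → cong (λ w → 𝟙 (a i (φ w) (merge mask y z))) (sym (merge-mergeˡ mask y z z₀))) ⟩
      sum ix (λ i → E (λ y → E (λ z → 𝟙 (h i (merge mask y z))))) ≡⟨ sum-cong ix (λ i → E-merge mask (𝟙 ∘ h i)) ⟨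
      sum ix b ∎
      where open ≤-Reasoning

    heavy? : Fin m → Bool
    heavy? i = does (decide-< (1ℚ - σ ^ d) (b i))

    heavy-true : ∀ {i} → heavy? i ≡ true → 1ℚ - σ ^ d < b i
    heavy-true {i} eq with decide-< (1ℚ - σ ^ d) (b i)
    ... | yes p = p

    heavies : List (Fin m)
    heavies = filter (λ i → heavy? i Bool.≟ true) ix

    b≤ : ∀ i → b i ≤ 1ℚ - σ ^ d + 𝟙 (heavy? i)
    b≤ i with decide-< (1ℚ - σ ^ d) (b i)
    ... | yes _ = ≤-trans (E≤1 (h i)) (≤-by (1ℚ - σ ^ d) (≤⇒0≤- (^≤1 d 0≤σ σ≤1)) (+-comm (1ℚ - σ ^ d) 1ℚ))
    ... | no ≮  = ≤-trans (≮⇒≥ ≮) (≤-reflexive (sym (+-identityʳ (1ℚ - σ ^ d))))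

    sum-b≤ : sum ix b ≤ ι m * (1ℚ - σ ^ d) + ι (length heavies)
    sum-b≤ = ≤-trans (sum-mono ix b≤) (≤-reflexive (trans (sum-+ ix (λ _ → 1ℚ - σ ^ d) (𝟙 ∘ heavy?))
      (cong₂ _+_ (trans (sum-const ix (1ℚ - σ ^ d)) (cong (λ l → ι l * (1ℚ - σ ^ d)) ix-length)) (sym (length-filter-sum ix heavy?)))))

    too-far : ∀ {i} → heavy? i ≡ true → ¬ σ ^ d ≤ E (λ x → 𝟙 (not (h i x)))
    too-far {i} hv le = <-irrefl refl (<-≤-trans (<-by (b i - (1ℚ - σ ^ d)) (<⇒0<- (heavy-true hv)) (lem (σ ^ d) (b i)))
        (≤-trans le (≤-reflexive (E-not (h i)))))
      where
      lem : ∀ a b → a ≡ 1ℚ - b + (b - (1ℚ - a))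
      lem = solve-∀ ℚ-ring

    not-h : ∀ {i x} → ¬ Q (it i) x ≈ V (g x) → not (h i x) ≡ true
    not-h {i} {x} ne with h i x in eq
    ... | true  = ⊥-elim (ne (a-true eq))
    ... | false = refl

    -- A member depending on a coordinate outside `C` differs from the core function `V ∘ g` with
    -- probability at least `σ ^ d`, by `distance-dep`; a heavy one is closer.
    heavy-core : ∀ {i} → heavy? i ≡ true → ∀ u → u ∉ C → Ign u (Q (it i))
    heavy-core {i} hv u u∉ x c = stable λ ne → too-far hv
      (distance-dep d {g = V ∘ g} (inJ (it i)) (λ x c → reflexive (cong V (g-ignores u∉ x c))) (λ ign → ne (ign x c)) {λ x → not (h i x)} (λ x → not-h {i} {x}))

    h-ignores : ∀ {i} → heavy? i ≡ true → ∀ u → u ∉ C → Ignores u (h i)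
    h-ignores {i} hv u u∉ x c = trans (cong (λ v → a i v (x [ u ]≔ c)) (g-ignores u∉ x c)) (a-ignores {i} {u} (heavy-core hv u u∉) (g x) x c)

    -- Agreement of a heavy member with `V ∘ g` depends on the core alone, so it is recorded at the
    -- representatives. Two members with the same record coincide wherever they agree with `V ∘ g`;
    -- their difference is nonzero with probability below `σ ^ d`, hence zero by `distance`.
    heavies-few : length heavies ℕ.≤ 2 ℕ.^ (s ℕ.^ length C)
    heavies-few with length heavies ℕ.≤? 2 ℕ.^ (s ℕ.^ length C)
    ... | yes le = le
    ... | no ≰ with same-pattern (representatives z₀ C) heavies h (AllPairsₚ.filter⁺ (λ i → heavy? i Bool.≟ true) (allFin⁺ m))
                      (subst (λ l → 2 ℕ.^ l ℕ.< length heavies) (sym (length-representatives z₀ C)) (ℕₚ.≰⇒> ≰))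
    ...   | i , j , i∈ , j∈ , i≢j , same = ⊥-elim (too-far hi
        (distance d (J-⊖ (inJ (it i)) (inJ (it j))) (λ v → distinct i j i≢j λ x → ⊖≈ε⁻¹ (v x)) covers))
      where
      hi : heavy? i ≡ true
      hi = proj₂ (∈-filter⁻ (λ i → heavy? i Bool.≟ true) {xs = ix} i∈)
      hj : heavy? j ≡ true
      hj = proj₂ (∈-filter⁻ (λ i → heavy? i Bool.≟ true) {xs = ix} j∈)
      at-rep : ∀ {l} → heavy? l ≡ true → ∀ {x y} → (∀ u → u ∈ C → lookup x u ≡ lookup y u) → h l x ≡ h l y
      at-rep {l} hv {x} {y} agree = connect {_~_ = _≡_} refl trans (h l) x y step
        where
        step : ∀ u → lookup x u ≡ lookup y u ⊎ Ignores u (h l)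
        step u with u ∈? C
        ... | yes u∈ = inj₁ (agree u u∈)
        ... | no u∉  = inj₂ (h-ignores hv u u∉)
      h-same : ∀ x → h i x ≡ h j x
      h-same x with representative z₀ C x
      ... | y , y∈ , agree = trans (at-rep hi agree) (trans (All.lookup same y∈) (sym (at-rep hj agree)))
      covers : Covers (λ x → not (h i x)) (λ x → Q (it i) x ⊖ Q (it j) x) (λ _ → ε)
      covers x ne with h i x in eq
      ... | false = refl
      ... | true  = ⊥-elim (ne (⊖≈ε (≈-trans (a-true eq) (≈-sym (a-true (trans (sym (h-same x)) eq))))))

    -- With `H` heavy members, `m (1 - σ^d + e) ≤ E W + m (1 - σ^d) + H`. Doubling and inserting
    -- `E-W` leaves `m e ≤ 2 (H + N)`, and `e = 1 / N`.
    few : m ℕ.≤ 2 ℕ.* N ℕ.* (2 ℕ.^ (s ℕ.^ length C) ℕ.+ N)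
    few = ℕₚ.≤-trans (ι-cancel-≤ (≤-trans (≤-by rhs-lhs nonneg eq) (≤-reflexive (sym ι-rhs))))
                     (ℕₚ.*-monoʳ-≤ (2 ℕ.* N) (ℕₚ.+-monoˡ-≤ N heavies-few))
      where
      H : ℚ
      H = ι (length heavies)
      ι-rhs : ι (2 ℕ.* N ℕ.* (length heavies ℕ.+ N)) ≡ ι 2 * ι N * (H + ι N)
      ι-rhs = trans (ι-* (2 ℕ.* N) (length heavies ℕ.+ N)) (cong₂ _*_ (ι-* 2 N) (ι-+ (length heavies) N))
      s₁ s₂ s₃ : ℚ
      s₁ = E W + E R - ι m * (1ℚ - σ ^ d + e)
      s₂ = ι m * (1ℚ - σ ^ d) + H - E R
      s₃ = ι m * e + 2ℚ * ι N - 2ℚ * E W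
      rhs-lhs : ℚ
      rhs-lhs = ι N * (2ℚ * s₁ + (2ℚ * s₂ + s₃))
      nonneg : 0ℚ ≤ rhs-lhs
      nonneg = 0≤* (0≤ι N) (0≤+ (0≤* (0≤+ 0≤1 0≤1) (≤⇒0≤- agreement)) (0≤+ (0≤* (0≤+ 0≤1 0≤1) (≤⇒0≤- (≤-trans E-R≤ sum-b≤))) (≤⇒0≤- E-W)))
      eq : ι 2 * ι N * (H + ι N) ≡ ι m + rhs-lhs
      eq = sym (begin
        ι m + rhs-lhs                                                ≡⟨ cong (_+ rhs-lhs) (trans (sym (*-identityʳ (ι m))) (cong (_*_ (ι m)) (sym (ι*recip N₀)))) ⟩
        ι m * (ι N * e) + rhs-lhs                                    ≡⟨ lem (ι m) (ι N) e (E W) (E R) (σ ^ d) H ⟩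
        ι 2 * ι N * (H + ι N) ∎)
        where
        open ≡-Reasoning
        lem : ∀ m n e w r p h → m * (n * e) + n * ((1ℚ + 1ℚ) * (w + r - m * (1ℚ - p + e)) + ((1ℚ + 1ℚ) * (m * (1ℚ - p) + h - r) + (m * e + (1ℚ + 1ℚ) * n - (1ℚ + 1ℚ) * w)))
              ≡ (1ℚ + (1ℚ + 0ℚ)) * n * (h + n)
        lem = solve-∀ ℚ-ring

  -- The conclusion is decidable, so the enumeration of values and the equality tests for
  -- `Sunflower` may be taken under double negation.
  core-bound : ∀ {C} (items : List (Item C)) → AllPairs Distinct items → AllPairs Disjoint items →
               length items ℕ.≤ coreBound (length C)
  core-bound [] _ _ = z≤n
  core-bound {C} items@(_ ∷ tail) distinct disjoint = decidable-stable (_ ℕ.≤? _) (do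
    k , V , V-distinct , cls ← classes (map f (cube n))
    dec ← ¬¬-∀Fin λ i → ¬¬-∀Cube λ x → ¬¬-∀Fin λ v → ¬¬-excluded-middle {A = Q (List.lookup items i) x ≈ V v}
    let value : ∀ x → ∃ λ v → f x ≈ V v
        value x = All.lookup cls (∈-map⁺ f (∈-cube x))
    return (Sunflower.few C (length tail) (List.lookup items)
      (AllPairs-index (λ ne same → ne λ x → ≈-sym (same x)) distinct)
      (AllPairs-index (λ dj u u∈ u∈′ → dj u u∈′ u∈) disjoint)
      k V V-distinct (λ x → proj₁ (value x)) (λ x → proj₂ (value x)) dec))

  coreBound-mono : ∀ {c c′} → c ℕ.≤ c′ → coreBound c ℕ.≤ coreBound c′
  coreBound-mono le = ℕₚ.*-monoʳ-≤ (2 ℕ.* N) (ℕₚ.+-monoˡ-≤ N (ℕₚ.^-monoʳ-≤ 2 (ℕₚ.^-monoʳ-≤ s le)))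

  union : ∀ {C} → List (Item C) → List (Fin n)
  union = concatMap rest

  -- An empty rest meets nothing, but has nothing to shrink either.
  Meets : ∀ {C} → List (Fin n) → Item C → Set
  Meets U p = Any (_∈ U) (rest p) ⊎ rest p ≡ []

  maximal-disjoint : ∀ {C} (items : List (Item C)) →
                     Σ (List (Item C)) λ ch → ch ⊆ items × AllPairs Disjoint ch × All (Meets (union ch)) items
  maximal-disjoint [] = [] , [] , [] , []
  maximal-disjoint (p ∷ items) with maximal-disjoint items
  ... | ch , sub , dj , meets with any? (λ u → u ∈? (union ch)) (rest p)
  ...   | yes hit = ch , p ∷ʳ sub , dj , inj₁ hit ∷ meets
  ...   | no miss = p ∷ ch , refl ∷ sub ,
                    All.tabulate (λ q∈ u u∈p u∈q → miss (Any.map (λ { refl → ∈-concatMap q∈ u∈q }) u∈p)) ∷ dj ,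
                    own (rest p) refl ∷ All.map (λ { (inj₁ hit) → inj₁ (Any.map (∈-++⁺ʳ (rest p)) hit) ; (inj₂ none) → inj₂ none }) meets
    where
    own : ∀ T → rest p ≡ T → Meets (union (p ∷ ch)) p
    own []      eq = inj₂ eq
    own (u ∷ T) eq = inj₁ (subst (Any (_∈ union (p ∷ ch))) (sym eq) (here (∈-++⁺ˡ (subst (u ∈_) (sym eq) (here refl)))))

  -- A maximal disjoint family has bounded size; moving its coordinates into the core shrinks every rest.
  count : ∀ k c {C} → length C ℕ.≤ c → (items : List (Item C)) → AllPairs Distinct items →
          All (λ p → length (rest p) ℕ.≤ k) items → length items ℕ.≤ listBound k c
  -- All rests are empty, so the whole list is disjoint.
  count zero c le items distinct small = ℕₚ.≤-trans (core-bound items distinct (empties small)) (coreBound-mono le)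
    where
    empties : ∀ {C} {items : List (Item C)} → All (λ p → length (rest p) ℕ.≤ 0) items → AllPairs Disjoint items
    empties [] = []
    empties {items = p ∷ _} (z ∷ zs) = All.tabulate (λ _ u u∈ → ⊥-elim (none z u∈)) ∷ empties zs
      where
      none : ∀ {T : List (Fin n)} {u} → length T ℕ.≤ 0 → u ∉ T
      none {_ ∷ _} () _
  count (suc k) c {C} le items distinct small with maximal-disjoint items
  ... | ch , sub , dj , meets = subst (ℕ._≤ _) (length-map enlarge items)
      (count k (c ℕ.+ coreBound c ℕ.* suc k) core≤ (map enlarge items) (AllPairsₚ.map⁺ distinct)
        (Allₚ.map⁺ (All.zipWith (λ {r} (p , q) → shrink {r} p q) (small , meets))))
    where
    U : List (Fin n)
    U = union ch
    P? = λ u → ¬? (u ∈? U)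
    enlarge : Item C → Item (C ++ U)
    enlarge p = record
      { Q = Q p ; inJ = inJ p ; χ = χ p ; cov = cov p ; close = close p
      ; rest = filter P? (rest p)
      ; only = λ u u∉ u∉′ → only p u (λ u∈ → u∉ (∈-++⁺ˡ u∈)) (λ u∈ → u∉′ (∈-filter⁺ P? u∈ (λ u∈U → u∉ (∈-++⁺ʳ C u∈U))))
      }
    shrink : ∀ {p} → length (rest p) ℕ.≤ suc k → Meets U p → length (rest (enlarge p)) ℕ.≤ k
    shrink {p} le (inj₁ hit)  = ℕₚ.≤-pred (ℕₚ.≤-trans (filter-notAll P? (rest p) (Any.map (λ u∈ u∉ → u∉ u∈) hit)) le)
    shrink {p} le (inj₂ none) = subst (λ T → length (filter P? T) ℕ.≤ k) (sym none) z≤n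
    ch≤ : length ch ℕ.≤ coreBound c
    ch≤ = ℕₚ.≤-trans (core-bound ch (AllPairs-resp sub distinct) dj) (coreBound-mono le)
      where
      AllPairs-resp : ∀ {xs ys : List (Item C)} → xs ⊆ ys → AllPairs Distinct ys → AllPairs Distinct xs
      AllPairs-resp []         []       = []
      AllPairs-resp (_ ∷ʳ sub) (_ ∷ ps) = AllPairs-resp sub ps
      AllPairs-resp (refl ∷ sub) (p ∷ ps) = All-resp-⊆ sub p ∷ AllPairs-resp sub ps
    union≤ : ∀ {ch : List (Item C)} → All (λ p → length (rest p) ℕ.≤ suc k) ch → length (union ch) ℕ.≤ length ch ℕ.* suc k
    union≤ []       = z≤n
    union≤ {p ∷ _} (l ∷ ls) = ℕₚ.≤-trans (ℕₚ.≤-reflexive (length-++ (rest p))) (ℕₚ.+-mono-≤ l (union≤ ls))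
    core≤ : length (C ++ U) ℕ.≤ c ℕ.+ coreBound c ℕ.* suc k
    core≤ = ℕₚ.≤-trans (ℕₚ.≤-reflexive (length-++ C)) (ℕₚ.+-mono-≤ le
              (ℕₚ.≤-trans (union≤ (All-resp-⊆ sub small)) (ℕₚ.*-monoˡ-≤ (suc k) ch≤)))

-- The bound on the length of the list is decidable, so equality in G may be weakened to its double negation.
stabilise : ∀ {c ℓ} → AbelianGroup c ℓ → AbelianGroup c ℓ
stabilise G = record
  { Carrier = Carrier
  ; _≈_     = λ x y → ¬ ¬ x ≈ y
  ; _∙_     = _∙_
  ; ε       = ε
  ; _⁻¹     = _⁻¹
  ; isAbelianGroup = record
    { isGroup = record
      { isMonoid = record
        { isSemigroup = record
          { isMagma = record
            { isEquivalence = record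
              { refl  = return ≈-refl
              ; sym   = λ p → p >>= λ p → return (≈-sym p)
              ; trans = λ p q → p >>= λ p → q >>= λ q → return (≈-trans p q)
              }
            ; ∙-cong = λ p q → p >>= λ p → q >>= λ q → return (∙-cong p q)
            }
          ; assoc = λ x y z → return (assoc x y z)
          }
        ; identity = (λ x → return (identityˡ x)) , (λ x → return (identityʳ x))
        }
      ; inverse = (λ x → return (inverseˡ x)) , (λ x → return (inverseʳ x))
      ; ⁻¹-cong = λ p → p >>= λ p → return (⁻¹-cong p)
      }
    ; comm = λ x y → return (comm x y)
    }
  }
  where
  open AbelianGroup G using (Carrier; _≈_; _∙_; ε; _⁻¹; ∙-cong; ⁻¹-cong; assoc; comm; identityˡ; identityʳ; inverseˡ; inverseʳ)
    renaming (refl to ≈-refl; sym to ≈-sym; trans to ≈-trans)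

-- A positive fraction is at least the reciprocal of its denominator.
recip-below : ∀ (eps : ℚ) → 0ℚ < eps → ∃ λ N₀ → recip N₀ ≤ eps
recip-below eps@(mkℚ (+ suc k) N₀ _) _ = N₀ , ≤-trans (≤-by (ι k * recip N₀) (0≤* (0≤ι k) (<⇒≤ (0<recip N₀))) refl)
    (≤-reflexive (trans (lem (recip N₀) (ι k)) (trans (cong (_*_ (ι (suc k))) (recip≡ N₀)) (trans (sym (/-as-* (suc k) (suc N₀))) (↥p/↧p≡p eps)))))
  where
  lem : ∀ a b → a + b * a ≡ (1ℚ + b) * a
  lem = solve-∀ ℚ-ring
recip-below (mkℚ (+ 0) _ _)      (*<* (ℤ.+<+ ()))
recip-below (mkℚ -[1+ _ ] _ _) (*<* ())

-- From the definitions of the statement to stable equality and Boolean events.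

module Transfer {c ℓ} (G : AbelianGroup c ℓ) (s₀ : ℕ) where
  open Expectation s₀
  open AbelianGroup G using (_≈_)

  G′ : AbelianGroup c ℓ
  G′ = stabilise G

  stable′ : ∀ {x y} → ¬ ¬ AbelianGroup._≈_ G′ x y → AbelianGroup._≈_ G′ x y
  stable′ h k = h λ p → p k

  open Juntas G′ stable′ s₀

  J-lift : ∀ {d} {P : Fn n} → InJ G s n d P → J d P
  J-lift {P = P} (gs , js , e) = gs , All.map (λ (S , l , h) → S , l , λ x y a → return (h x y a)) js ,
                                 λ x → return (subst (P x ≈_) (sums gs x) (e x))
    where
    sums : ∀ (gs : List (Fn n)) x → Defs.sumFns G gs x ≡ Defs.sumFns G′ gs x
    sums []       x = refl
    sums (g ∷ gs) x = cong (AbelianGroup._∙_ G (g x)) (sums gs x)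

  orders-lift : ∀ {p} → OrdersExceed G p → OrdersExceed G′ p
  orders-lift ord g ne k 1≤k k≤p eq = eq λ kg≈ε → ord g (λ g≈ε → ne (return g≈ε)) k 1≤k k≤p (subst (_≈ AbelianGroup.ε G) (mults k) kg≈ε)
    where
    mults : ∀ k → Defs.mult G′ k g ≡ Defs.mult G k g
    mults zero    = refl
    mults (suc k) = cong (AbelianGroup._∙_ G g) (mults k)

  distinct-lift : ∀ {P Q : Fn n} → Defs.Distinct G P Q → ¬ (∀ x → ¬ ¬ P x ≈ Q x)
  distinct-lift ne h = ¬¬-∀Cube h ne

  σ^≡ : ∀ k .{{_ : NonZero (s ℕ.^ k)}} → (+ 1) / (s ℕ.^ k) ≡ σ ^ k
  σ^≡ k = begin
    u                          ≡⟨ trans (sym (*-identityʳ u)) (cong (_*_ u) (sym (ιs^*σ^ k))) ⟩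
    u * (ι s ^ k * σ ^ k)      ≡⟨ lem u (ι s ^ k) (σ ^ k) ⟩
    (ι s ^ k * u) * σ ^ k      ≡⟨ cong (_* σ ^ k) (trans (cong (_* u) (sym (ι-^ s k))) (ι*1/ (s ℕ.^ k))) ⟩
    1ℚ * σ ^ k                 ≡⟨ *-identityˡ (σ ^ k) ⟩
    σ ^ k ∎
    where
    open ≡-Reasoning
    u = (+ 1) / (s ℕ.^ k)
    lem : ∀ a b c → a * (b * c) ≡ (b * a) * c
    lem = solve-∀ ℚ-ring

  Close : (e : ℚ) (d : ℕ) (f P : Fn n) → Set _
  Close {n} e d f P = Σ (Cube s n → Bool) λ χ → Covers χ P f × E (𝟙 ∘ χ) ≤ σ ^ d - e

  -- Membership in the list of exceptional points is the Boolean event; a union bound over its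
  -- entries, each of mass `σ ^ n`, bounds the probability.
  close-lift : ∀ {eps e d} {f P : Fn n} → e ≤ eps → DistLe G s n f P (radius s d eps) → Close e d f P
  close-lift {n} {eps} {e} {d} {f} {P} e≤eps (L , _ , covers , small) = χ , cov , bound
    where
    _∈ᶜ?_ = DecMembership._∈?_ (Vecₚ.≡-dec {n = n} (Fin._≟_ {s}))
    χ : Cube s n → Bool
    χ x = does (x ∈ᶜ? L)
    cov : Covers χ P f
    cov x ne with x ∈ᶜ? L
    ... | yes _ = refl
    ... | no x∉ = ⊥-elim (ne λ ne′ → x∉ (covers x λ f≈P → ne′ (AbelianGroup.sym G f≈P)))
    pointwise : ∀ x (L : List (Cube s n)) → 𝟙 (does (x ∈ᶜ? L)) ≤ sum L (λ y → 𝟙 (x ≟ᶜ y))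
    pointwise x []      = ≤-refl
    pointwise x (y ∷ L) with Vecₚ.≡-dec Fin._≟_ x y | x ∈ᶜ? L | pointwise x L
    ... | yes _ | _     | _  = ≤-by (sum L (λ y → 𝟙 (x ≟ᶜ y))) (sum-≥0 L λ y → 0≤𝟙 (x ≟ᶜ y)) refl
    ... | no _  | yes _ | le = ≤-trans le (≤-reflexive (sym (+-identityˡ _)))
    ... | no _  | no _  | le = ≤-trans le (≤-reflexive (sym (+-identityˡ _)))
    bound : E (𝟙 ∘ χ) ≤ σ ^ d - e
    bound = begin
      E (𝟙 ∘ χ)                                        ≤⟨ E-mono (λ x → pointwise x L) ⟩
      E (λ x → sum L (λ y → 𝟙 (x ≟ᶜ y)))               ≡⟨ E-sum L (λ y x → 𝟙 (x ≟ᶜ y)) ⟩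
      sum L (λ y → E (λ x → 𝟙 (x ≟ᶜ y)))               ≡⟨ trans (sum-cong L E-point) (sum-const L (σ ^ n)) ⟩
      ι (length L) * σ ^ n                             ≡⟨ trans (/-as-* (length L) (s ℕ.^ n) {{nz}}) (cong (_*_ (ι (length L))) (σ^≡ n {{nz}})) ⟨
      ((+ length L) / (s ℕ.^ n)) {{nz}}                ≤⟨ small ⟩
      radius s d eps                                   ≡⟨ cong (_- eps) (σ^≡ d {{ℕₚ.m^n≢0 s d}}) ⟩
      σ ^ d - eps                                      ≤⟨ +-monoʳ-≤ (σ ^ d) (neg-antimono-≤ e≤eps) ⟩
      σ ^ d - e ∎
      where
      open ≤-Reasoning
      nz = ℕₚ.m^n≢0 s n

  -- The complement of `χ` has probability at least `e > 0`, so some point lies in it.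
  agrees-somewhere : ∀ {e d} {f P : Fn n} → 0ℚ < e → Close e d f P → ∃ λ z → AbelianGroup._≈_ G′ (P z) (f z)
  agrees-somewhere {e = e} {d} {f} {P} pos (χ , cov , small) with E-attained (λ x → 𝟙 (not (χ x)))
  ... | z , le with χ z in eq
  ...   | false = z , uncovered cov eq
  ...   | true  = ⊥-elim (<-irrefl refl (<-≤-trans pos (≤-trans (≤-by (1ℚ - σ ^ d + (σ ^ d - e - E (𝟙 ∘ χ)))
                    (0≤+ (≤⇒0≤- (^≤1 d 0≤σ σ≤1)) (≤⇒0≤- small)) (lem (σ ^ d) e (E (𝟙 ∘ χ)))) (≤-trans (≤-reflexive (sym (E-not χ))) le))))
    where
    lem : ∀ a b c → 1ℚ - c ≡ b + (1ℚ - a + (a - b - c))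
    lem = solve-∀ ℚ-ring

-- Assembling the list bound.

module Main (s₁ N₀ d : ℕ) where
  s₀ : ℕ
  s₀ = suc s₁
  open Expectation s₀
  open Constants s₀ N₀
  open Bounds s₀ N₀

  L : ℕ
  -- The extra one counts the member that is subtracted from all others.
  L = suc (listBound (K d) 0)

  decodable : ∀ {eps} → e ≤ eps → ∀ {c ℓ} (G : AbelianGroup c ℓ) → OrdersExceed G (8 ℕ.* N) →
              ∀ n → ListDecodable G s n (InJ G s n d) (radius s d eps) L
  decodable e≤eps G ord n f []        _ _ _ = z≤n
  decodable {eps} e≤eps {c} {ℓ} G ord n f (P₁ ∷ Ps) (j₁ ∷ js) (_ ∷ ds) (cl₁ ∷ cls) =
    s≤s (decidable-stable (_ ℕ.≤? _) (do
      items , len , distinct , small , _ ← build js ds cls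
      return (ℕₚ.≤-trans (ℕₚ.≤-reflexive (sym len)) (count (K d) 0 z≤n items distinct small))))
    where
    open Transfer G s₀
    open Juntas G′ stable′ s₀
    open JuntaStructure G′ stable′ s₀ N₀ (orders-lift ord) using (junta; Junta)
    open AbelianGroup G′ using (_≈_) renaming (refl to ≈-refl; sym to ≈-sym; trans to ≈-trans)
    f′ : Fn n
    f′ x = f x ⊖ P₁ x
    open Lists G′ stable′ s₀ N₀ d n f′
    open Item

    shift-cancel : ∀ {x y z} → x ⊖ z ≈ y ⊖ z → x ≈ y
    shift-cancel = ∙-cancelʳ _ _ _
      where open AbelianGroupₚ G′ using (∙-cancelʳ)

    item : ∀ {P} → InJ G s n d P → DistLe G s n f P (radius s d eps) →
           ¬ ¬ (Σ (Item []) λ p → length (rest p) ℕ.≤ K d × (∀ x → Q p x ≈ P x ⊖ P₁ x))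
    item {P} j cl = do
      S , l , o ← junta d {λ x → P x ⊖ P₁ x} (J-⊖ (J-lift j) (J-lift j₁)) {λ x → χP x ∨ χ₁ x} cover sizes
      -- The core starts empty, and all relevant coordinates of the difference form `rest`.
      return (record { Q = λ x → P x ⊖ P₁ x ; inJ = J-⊖ (J-lift j) (J-lift j₁) ; χ = χP
                     ; cov = λ x ne → covP x λ eq → ne (⊖-cong eq ≈-refl) ; close = closeP
                     ; rest = S ; only = λ u _ u∉ → o u u∉ } , l , λ x → ≈-refl)
      where
      near : Close e d f P
      near = close-lift {eps = eps} {d = d} e≤eps cl
      near₁ : Close e d f P₁
      near₁ = close-lift {eps = eps} {d = d} e≤eps cl₁
      χP χ₁ : Cube s n → Bool
      χP = proj₁ near
      χ₁ = proj₁ near₁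
      covP : Covers χP P f
      covP = proj₁ (proj₂ near)
      cov₁ : Covers χ₁ P₁ f
      cov₁ = proj₁ (proj₂ near₁)
      closeP : E (𝟙 ∘ χP) ≤ σ ^ d - e
      closeP = proj₂ (proj₂ near)
      close₁ : E (𝟙 ∘ χ₁) ≤ σ ^ d - e
      close₁ = proj₂ (proj₂ near₁)
      cover : Covers (λ x → χP x ∨ χ₁ x) (λ x → P x ⊖ P₁ x) (λ _ → AbelianGroup.ε G′)
      cover x ne with χP x in p | χ₁ x in q
      ... | true  | _     = refl
      ... | false | true  = refl
      ... | false | false = ⊥-elim (ne (⊖≈ε (≈-trans (uncovered covP p) (≈-sym (uncovered cov₁ q)))))
      sizes : E (λ x → 𝟙 (χP x ∨ χ₁ x)) ≤ ι s * σ ^ d - e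
      -- This is where `s ≥ 2` enters: `2 (σ^d - e) ≤ s σ^d - e`.
      sizes = ≤-trans (E-∨ χP χ₁) (≤-trans (+-mono-≤ closeP close₁)
        (≤-by (ι s₁ * σ ^ d + e) (0≤+ (0≤* (0≤ι s₁) (0≤^ d 0≤σ)) (<⇒≤ (0<recip N₀))) (lem (ι s₁) (σ ^ d) e)))
        where
        lem : ∀ a b c → (1ℚ + (1ℚ + a)) * b - c ≡ b - c + (b - c) + (a * b + c)
        lem = solve-∀ ℚ-ring

    Matches : Item [] → Fn n → Set _
    Matches p P = ∀ x → Q p x ≈ P x ⊖ P₁ x
    separate : ∀ (p : Item []) {P Ps} {items : List (Item [])} → Matches p P → All (Defs.Distinct G P) Ps → Pointwise Matches items Ps → All (Distinct p) items
    separate p mp []       []       = []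
    separate p mp (d ∷ ds) (m ∷ ms) =
      (λ same → distinct-lift d λ x → shift-cancel (≈-trans (≈-sym (mp x)) (≈-trans (same x) (m x)))) ∷ separate p mp ds ms
    build : ∀ {Ps} → All (InJ G s n d) Ps → AllPairs (Defs.Distinct G) Ps → All (λ P → DistLe G s n f P (radius s d eps)) Ps →
         ¬ ¬ (Σ (List (Item [])) λ items → length items ≡ length Ps × AllPairs Distinct items ×
              All (λ p → length (rest p) ℕ.≤ K d) items × Pointwise Matches items Ps)
    build []       []       []       = return ([] , refl , [] , [] , [])
    build (j ∷ js) (d ∷ ds) (c ∷ cs) = do
      p , l , m ← item j c
      items , len , distinct , small , ms ← build js ds cs
      return (p ∷ items , cong suc len , separate p m d ms ∷ distinct , l ∷ small , m ∷ ms)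

-- For s = 1 the cube is a single point, on which all the functions in the list agree.
decodable₁ : ∀ (eps : ℚ) → 0ℚ < eps → ∀ d {c ℓ} (G : AbelianGroup c ℓ) n → ListDecodable G 1 n (InJ G 1 n d) (radius 1 d eps) 1
decodable₁ eps pos d G n f []       _ _ _ = z≤n
decodable₁ eps pos d G n f (P ∷ []) _ _ _ = s≤s z≤n
decodable₁ eps pos d G n f (P ∷ P′ ∷ Ps) _ ((d₁ ∷ _) ∷ _) (c₁ ∷ c₂ ∷ _) =
  ⊥-elim (distinct-lift d₁ λ x → AbelianGroup.trans G′ (exact c₁ x) (AbelianGroup.sym G′ (exact c₂ x)))
  where
  open Transfer G 0
  single : ∀ {n} (x y : Cube 1 n) → x ≡ y
  single []         []         = refl
  single (zero ∷ x) (zero ∷ y) = cong (zero ∷_) (single x y)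
  exact : ∀ {P} → DistLe G 1 n f P (radius 1 d eps) → ∀ x → AbelianGroup._≈_ G′ (P x) (f x)
  exact {P} cl x = subst (λ z → AbelianGroup._≈_ G′ (P z) (f z)) (single (proj₁ agreement) x) (proj₂ agreement)
    where
    agreement : ∃ λ z → AbelianGroup._≈_ G′ (P z) (f z)
    agreement = agrees-somewhere {d = d} {f} {P} pos (close-lift {eps = eps} {d = d} {f} {P} ≤-refl cl)

theoremD1 : (eps : ℚ) → 0ℚ < eps → (s d : ℕ) → .{{_ : NonZero s}} → 0 ℕ.< d →
    ∃₂ω (λ p L → ∀ {c ℓ} (G : AbelianGroup c ℓ) → OrdersExceed G p →
    (n : ℕ) → ListDecodable G s n (InJ G s n d) (radius s d eps) L)
theoremD1 eps pos zero d {{nz}} _ = absurd (ℕ.≢-nonZero⁻¹ 0 {{nz}} refl)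
  where
  absurd : ∀ {P} → ⊥ → ∃₂ω P
  absurd ()
theoremD1 eps pos 1 d _ = mk∃₂ω 0 1 λ G _ n → decodable₁ eps pos d G n
theoremD1 eps pos (suc (suc s₁)) d _ with recip-below eps pos
-- `p` equals `M`, because the peeling in `block` translates sets of at most `M` values.
... | N₀ , e≤eps = mk∃₂ω (8 ℕ.* suc N₀) (Main.L s₁ N₀ d) λ G ord n → Main.decodable s₁ N₀ d e≤eps G ord n
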